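{- There exists $b_0$ such that the following holds. Let $a,b,c$ be positive integers with $a\leq b\leq c\leq b^{1.01}$, $b\geq b_0$, $\gcd(b,c)=1$ and $c\neq a+b$. Then there is a constant $\kappa>0$ such that for every positive integer $N$ there exists a set $A\subseteq\{1,2,\dots,N\}$ with $|A|\geq \kappa N^{1/4.77}$ such that $A$ contains no non-trivial solutions to the equation $ax+by+cz=ax'+by'+cz'$.
   Context: A solution $(x,y,z,x',y',z')$ (all variables in $A$) of $ax+by+cz=ax'+by'+cz'$ is trivial if, viewing the equation as $ax+by+cz-ax'-by'-cz'=0$, for every value $\alpha$ the coefficients of those variables taking the value $\alpha$ sum to zero. A solution is non-trivial if it is not trivial. -}

module Defs where

open import Data.Nat using (ℕ; _≡ᵇ_)
open import Data.Bool using (if_then_else_)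
open import Data.Integer using (ℤ; +_; _+_; _-_; _*_)
open import Relation.Binary.PropositionalEquality using (_≡_)

ind : ℕ → ℕ → ℤ
ind α x = if x ≡ᵇ α then + 1 else + 0

-- Viewing a x + b y + c z - a x' - b y' - c z' = 0, the solution
-- (x,y,z,x',y',z') is trivial if for every value α the coefficients of
-- the variables taking value α sum to zero.
Trivial : (a b c x y z x' y' z' : ℕ) → Set
Trivial a b c x y z x' y' z' =
  ∀ (α : ℕ) →
    (+ a * ind α x + + b * ind α y + + c * ind α z
      - + a * ind α x' - + b * ind α y' - + c * ind α z') ≡ + 0

{-# OPTIONS --safe #-}

-- The set A consists of the numbers whose digits in base M = (a + b + c) L are
-- the base-L digits of the elements of an auxiliary set S.  Solutions in A do not
-- carry, so they solve the equation digit by digit, and any linear relation forced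
-- on digit solutions holds between the elements of S.
--
-- Write b ≈ 2 t²⁶.  For a < b take R = t⁷.  If the equation has no nontrivial
-- solution in [0, R), take L = R and S everything.  Otherwise fix such a solution,
-- with differences (u, v, w), and take L = t¹⁹: the cross product of (u, v, w) with
-- the differences of a digit solution has entries divisible by c and by b, so
-- these vanish and every digit solution is parallel to (u, v, w).  As c ≠ a + b,
-- two of u, v, w are nonzero of distinct absolute value, and S has size about
-- √X in [0, X) and admits no differences in that ratio.  For a = b take L = t²⁶:
-- digit solutions satisfy z = z′ and x + y = x′ + y′, so S is a Sidon set.
-- The three parameter choices give exponents above 100/477.
module Submission where

open import Defs
open import Data.Empty using (⊥)
open import Data.Integer using (ℤ; +_; ∣_∣)
import Data.Integer as ℤ
import Data.Integer.Divisibility.Signed as ℤ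
import Data.Integer.Properties as ℤ
import Data.Integer.Tactic.RingSolver as ℤ-Solver
open import Data.List using (List; []; _∷_; applyUpTo; length)
open import Data.List.Membership.Propositional using (_∈_)
open import Data.List.Membership.Propositional.Properties using (∈-applyUpTo⁻)
open import Data.List.Properties using (length-applyUpTo)
open import Data.List.Relation.Unary.All using (All; []; _∷_)
import Data.List.Relation.Unary.All.Properties as All
open import Data.List.Relation.Unary.Unique.Propositional using (Unique)
import Data.List.Relation.Unary.Unique.Propositional.Properties as Unique
open import Data.Nat
open import Data.Nat.Coprimality using (Coprime; coprime-divisor; coprime-/gcd)
import Data.Nat.Coprimality as Coprimality
open import Data.Nat.Divisibility
open import Data.Nat.DivMod
open import Data.Nat.GCD using (gcd; gcd[m,n]∣m; gcd[m,n]∣n; gcd[m,n]≢0)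
open import Data.Nat.ListAction using (product)
open import Data.Nat.Primality
open import Data.Nat.Primality.Factorisation using (factorise; module PrimeFactorisation)
open import Data.Nat.Properties
open import Data.Nat.Tactic.RingSolver using (solve-∀)
open import Data.Product using (Σ; ∃; _×_; _,_; ∃-syntax; proj₁; proj₂)
open import Data.Sum using (_⊎_; inj₁; inj₂; [_,_]′)
open import Function.Bundles using (_⇔_; mk⇔; Equivalence)
open import Relation.Binary.Definitions using (tri<; tri≈; tri>)
open import Relation.Binary.PropositionalEquality
open import Relation.Nullary using (Dec; yes; no; contradiction; ¬_; ¬?; _×-dec_)
open import Relation.Nullary.Decidable using (decidable-stable)

open Equivalence using (to; from)

-- Primes in short intervals

-- Found by searching downwards from `m`. It supplies integer logarithms and integer roots.
bracket : ∀ (f : ℕ → ℕ) N m → f 0 ≤ N → N < f m → ∃[ k ] (f k ≤ N × N < f (suc k))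
bracket f N zero    f0≤N N<f0 = contradiction f0≤N (<⇒≱ N<f0)
bracket f N (suc m) f0≤N N<fsm with f m ≤? N
... | yes fm≤N = m , fm≤N , N<fsm
... | no  fm≰N = bracket f N m f0≤N (≰⇒> fm≰N)

n<B^n : ∀ {B} → 2 ≤ B → ∀ n → n < B ^ n
n<B^n 2≤B zero = s≤s z≤n
n<B^n {B} 2≤B (suc n) = begin-strict
  suc n         <⟨ s≤s (n<B^n 2≤B n) ⟩
  suc (B ^ n)   ≤⟨ +-monoˡ-≤ (B ^ n) (≤-trans (s≤s z≤n) (n<B^n 2≤B n)) ⟩
  B ^ n + B ^ n ≡⟨ cong (_+_ (B ^ n)) (+-identityʳ (B ^ n)) ⟨
  2 * B ^ n     ≤⟨ *-monoˡ-≤ (B ^ n) 2≤B ⟩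
  B * B ^ n     ∎
  where open ≤-Reasoning

log-bracket : ∀ {B} → 2 ≤ B → ∀ {N} → 1 ≤ N → ∃[ k ] (B ^ k ≤ N × N < B ^ suc k)
log-bracket {B} 2≤B {N} 1≤N = bracket (B ^_) N N 1≤N (n<B^n 2≤B N)

^-cancelʳ-≤ : ∀ {B} → 1 < B → ∀ m n → B ^ m ≤ B ^ n → m ≤ n
^-cancelʳ-≤ {B} 1<B m n h with m ≤? n
... | yes m≤n = m≤n
... | no  m≰n = contradiction h (<⇒≱ (^-monoʳ-< B 1<B (≰⇒> m≰n)))

^-cancelˡ-≤ : ∀ k .{{_ : NonZero k}} {m n} → m ^ k ≤ n ^ k → m ≤ n
^-cancelˡ-≤ k {m} {n} h with m ≤? n
... | yes m≤n = m≤n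
... | no  m≰n = contradiction h (<⇒≱ (^-monoˡ-< k (≰⇒> m≰n)))

^-distribʳ-* : ∀ k m n → (m * n) ^ k ≡ m ^ k * n ^ k
^-distribʳ-* zero    m n = refl
^-distribʳ-* (suc k) m n = trans (cong (m * n *_) (^-distribʳ-* k m n)) (exchange m n (m ^ k) (n ^ k))
  where
  exchange : ∀ m n x y → m * n * (x * y) ≡ m * x * (n * y)
  exchange = solve-∀

-- A Chebyshev-type lower bound for common multiples of 1, …, K: the iterated
-- differences of T/(i+1) are the integers T i! c! / (i+c+1)!.
leibniz-∣ : ∀ {T K} → (∀ j → 1 ≤ j → j ≤ K → j ∣ T) →
            ∀ c i → i + c < K → suc (i + c) ! ∣ T * (i ! * c !)
leibniz-∣ {T} h zero i i+0<K rewrite +-identityʳ i | *-identityʳ (i !) =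
  *-monoˡ-∣ (i !) (h (suc i) (s≤s z≤n) i+0<K)
leibniz-∣ {T} h (suc c) i i+sc<K rewrite +-suc i c =
  ∣m+n∣m⇒∣n (subst (suc (suc (i + c)) ! ∣_) (split T (i !) (c !) i c)
               (*-monoʳ-∣ (suc (suc (i + c))) (leibniz-∣ h c i (<-trans (n<1+n _) i+sc<K))))
            (leibniz-∣ h c (suc i) i+sc<K)
  where
  split : ∀ T x y i c → suc (suc (i + c)) * (T * (x * y)) ≡
                        T * ((suc i * x) * y) + T * (x * (suc c * y))
  split = solve-∀

-- From `n` to `suc n` the left side grows by the factor `(2n+2)²`, the right side by the larger
-- `(2n+3)(2n+2)`.
central-factorial : ∀ n → 4 ^ n * (n ! * n !) ≤ suc (n + n) !
central-factorial zero = ≤-refl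
central-factorial (suc n) rewrite +-suc n n = begin
  4 ^ suc n * (suc n ! * suc n !)                     ≡⟨ shuffle (4 ^ n) (n !) n ⟩
  (2 * suc n) * (2 * suc n) * (4 ^ n * (n ! * n !))   ≤⟨ *-mono-≤ coeff (central-factorial n) ⟩
  suc (suc (suc (n + n))) * suc (suc (n + n)) * suc (n + n) !
    ≡⟨ *-assoc (suc (suc (suc (n + n)))) (suc (suc (n + n))) (suc (n + n) !) ⟩
  suc (suc (suc (n + n))) !                           ∎
  where
  open ≤-Reasoning
  shuffle : ∀ F x n → (4 * F) * ((suc n * x) * (suc n * x)) ≡ (2 * suc n) * (2 * suc n) * (F * (x * x))
  shuffle = solve-∀
  double : ∀ n → 2 * suc n ≡ suc (suc (n + n))
  double = solve-∀
  coeff : (2 * suc n) * (2 * suc n) ≤ suc (suc (suc (n + n))) * suc (suc (n + n))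
  coeff = *-mono-≤ (≤-trans (≤-reflexive (double n)) (n≤1+n _)) (≤-reflexive (double n))

-- The case `i = c = n` of `leibniz-∣`: `(2n+1)!` divides the nonzero `T * (n ! * n !)`, so it
-- cannot exceed it.
common-multiple-≥ : ∀ {T K} .{{_ : NonZero T}} → (∀ j → 1 ≤ j → j ≤ K → j ∣ T) →
                    ∀ n → n + n < K → 4 ^ n ≤ T
common-multiple-≥ {T} h n n+n<K = *-cancelʳ-≤ (4 ^ n) T (n ! * n !) (begin
  4 ^ n * (n ! * n !) ≤⟨ central-factorial n ⟩
  suc (n + n) !       ≤⟨ ∣⇒≤ (leibniz-∣ h n n n+n<K) ⟩
  T * (n ! * n !)     ∎)
  where
  open ≤-Reasoning
  instance
    _ = n !* n !≢0
    _ = m*n≢0 T (n ! * n !)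

n!≤n^n : ∀ n → n ! ≤ n ^ n
n!≤n^n n = go n ≤-refl
  where
  go : ∀ m → m ≤ n → m ! ≤ n ^ m
  go zero    _    = ≤-refl
  go (suc m) sm≤n = *-mono-≤ sm≤n (go m (≤-trans (n≤1+n m) sm≤n))

m∣n! : ∀ {m n} → 1 ≤ m → m ≤ n → m ∣ n !
m∣n! {suc m} 1≤m m≤n = ∣-trans (m∣m*n (m !)) (m≤n⇒m!∣n! m≤n)

prime⇒≥2 : ∀ {p} → Prime p → 2 ≤ p
prime⇒≥2 {p} pp = nonTrivial⇒n>1 p {{prime⇒nonTrivial pp}}

module _ {B Y} (small : ∀ p → Prime p → p ≤ B → p ≤ Y) where

  -- Each factor is at most `Y` and thus divides `Y !`. The second component bounds the number of
  -- factors, for use in `smooth-∣`.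
  product-∣-power : ∀ ps → All Prime ps → product ps ≤ B →
                    product ps ∣ (Y !) ^ length ps × 2 ^ length ps ≤ product ps
  product-∣-power [] [] _ = ∣-refl , ≤-refl
  product-∣-power (p ∷ ps) (pp ∷ pps) h
    with product-∣-power ps pps (≤-trans (m≤n*m (product ps) p {{prime⇒nonZero pp}}) h)
  ... | dvd , len = *-pres-∣ (m∣n! (≤-trans (s≤s z≤n) (prime⇒≥2 pp)) (small p pp p≤B)) dvd
                  , *-mono-≤ (prime⇒≥2 pp) len
    where
    p≤B : p ≤ B
    p≤B = ≤-trans (m≤m*n p (product ps) {{>-nonZero (≤-trans (m^n>0 2 (length ps)) len)}}) h

  -- A number up to `2 ^ e` has at most `e` prime factors with multiplicity, so one exponent serves
  -- all `j`.
  smooth-∣ : ∀ e → B ≤ 2 ^ e → ∀ j → 1 ≤ j → j ≤ B → j ∣ (Y !) ^ e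
  smooth-∣ e B≤2^e j@(suc _) 1≤j j≤B
    with product-∣-power (factors (factorise j)) (factorsPrime (factorise j))
           (subst (_≤ B) (isFactorisation (factorise j)) j≤B)
    where open PrimeFactorisation
  ... | dvd , len = subst (_∣ (Y !) ^ e) (sym (isFactorisation (factorise j)))
      (∣-trans dvd (^-monoʳ-∣ (^-cancelʳ-≤ (s≤s (s≤s z≤n)) (length (factors (factorise j))) e
         (≤-trans len (subst (_≤ 2 ^ e) (isFactorisation (factorise j)) (≤-trans j≤B B≤2^e))))))
    where
    open PrimeFactorisation
    ^-monoʳ-∣ : ∀ {m n} → m ≤ n → (Y !) ^ m ∣ (Y !) ^ n
    ^-monoʳ-∣ {m} {n} m≤n = subst (λ k → (Y !) ^ m ∣ (Y !) ^ k) (m+[n∸m]≡n m≤n)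
      (subst ((Y !) ^ m ∣_) (sym (^-distribˡ-+-* (Y !) m (n ∸ m))) (m∣m*n ((Y !) ^ (n ∸ m))))

-- Used in `prime-between`, where `B = 2 ^ s * Y` has to beat `56 s² Y + 2`. The inequality fails at
-- `s = 13`.
quadratic<exponential : ∀ {s} → 14 ≤ s → 56 * (s * s) + 1 ≤ 2 ^ s
quadratic<exponential {suc s} 14≤1+s with m≤n⇒m<n∨m≡n 14≤1+s
... | inj₂ refl = ≤ᵇ⇒≤ _ _ _
... | inj₁ (s≤s 14≤s) = begin
  56 * (suc s * suc s) + 1         ≡⟨ expand s ⟩
  56 * (s * s) + 1 + (112 * s + 56) ≤⟨ +-monoʳ-≤ (56 * (s * s) + 1) linear ⟩
  56 * (s * s) + 1 + (56 * (s * s) + 1) ≡⟨ double (56 * (s * s) + 1) ⟩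
  2 * (56 * (s * s) + 1)           ≤⟨ *-monoʳ-≤ 2 (quadratic<exponential 14≤s) ⟩
  2 * 2 ^ s                        ∎
  where
  open ≤-Reasoning
  expand : ∀ s → 56 * (suc s * suc s) + 1 ≡ 56 * (s * s) + 1 + (112 * s + 56)
  expand = solve-∀
  double : ∀ x → x + x ≡ 2 * x
  double = solve-∀
  regroup : ∀ s → 112 * s + 56 * s ≡ 56 * (3 * s)
  regroup = solve-∀
  linear : 112 * s + 56 ≤ 56 * (s * s) + 1
  linear = begin
    112 * s + 56      ≤⟨ +-monoʳ-≤ (112 * s) (m≤m*n 56 s {{>-nonZero (≤-trans (s≤s z≤n) 14≤s)}}) ⟩
    112 * s + 56 * s  ≡⟨ regroup s ⟩
    56 * (3 * s)      ≤⟨ *-monoʳ-≤ 56 (*-monoˡ-≤ s (≤-trans (s≤s (s≤s (s≤s z≤n))) 14≤s)) ⟩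
    56 * (s * s)      ≤⟨ m≤m+n (56 * (s * s)) 1 ⟩
    56 * (s * s) + 1  ∎

-- Without a prime in the interval, (Y !) ^ (8 s) with Y = 2 ^ (7 s) would be a
-- common multiple of 1, …, 2 ^ (8 s), but it is too small for that.
prime-between : ∀ s → 14 ≤ s → ∃[ p ] (Prime p × 2 ^ (7 * s) < p × p ≤ 2 ^ (8 * s))
prime-between s@(suc s′) 14≤s
  with anyUpTo? (λ p → prime? p ×-dec (2 ^ (7 * s) <? p)) (suc (2 ^ (8 * s)))
... | yes (p , s≤s p≤ , pp , p>) = p , pp , p> , p≤
... | no none = contradiction bound (<⇒≱ big)
  where
  open ≤-Reasoning
  Y = 2 ^ (7 * s)
  B = 2 ^ (8 * s)
  -- Half of `B`, so that `n = h − 1` is the largest number with `n + n < B`.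
  h = 2 ^ (7 + 8 * s′)
  T = (Y !) ^ (8 * s)
  instance
    _ : NonZero h
    _ = m^n≢0 2 (7 + 8 * s′)
    _ : NonZero (Y !)
    _ = Y !≢0
  small : ∀ p → Prime p → p ≤ B → p ≤ Y
  small p pp p≤B with p ≤? Y
  ... | yes p≤Y = p≤Y
  ... | no  p≰Y = contradiction (p , s≤s p≤B , pp , ≰⇒> p≰Y) none
  n = pred h
  exponent : ∀ k → 8 * suc k ≡ 1 + (7 + 8 * k)
  exponent = solve-∀
  2+n+n≡B : 2 + (n + n) ≡ B
  2+n+n≡B = begin-equality
    2 + (n + n)            ≡⟨ cong suc (sym (+-suc n n)) ⟩
    suc n + suc n          ≡⟨ cong (λ m → m + m) (suc-pred h) ⟩
    h + h                  ≡⟨ cong (_+_ h) (+-identityʳ h) ⟨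
    2 ^ (1 + (7 + 8 * s′)) ≡⟨ cong (2 ^_) (exponent s′) ⟨
    B                      ∎
  4^n≤T : 4 ^ n ≤ T
  4^n≤T = common-multiple-≥ {T} {B} {{m^n≢0 (Y !) (8 * s)}} (smooth-∣ small (8 * s) ≤-refl) n
            (subst (n + n <_) 2+n+n≡B (n≤1+n _))
  -- Binary logarithms of `4 ^ n ≤ T`, with `Y !` estimated by `Y ^ Y = 2 ^ (7 s Y)`.
  bound : n + n ≤ 7 * s * Y * (8 * s)
  bound = ^-cancelʳ-≤ (s≤s (s≤s z≤n)) (n + n) (7 * s * Y * (8 * s)) (begin
    2 ^ (n + n)             ≡⟨ cong (2 ^_) (cong (_+_ n) (+-identityʳ n)) ⟨
    2 ^ (2 * n)             ≡⟨ ^-*-assoc 2 2 n ⟨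
    4 ^ n                   ≤⟨ 4^n≤T ⟩
    (Y !) ^ (8 * s)         ≤⟨ ^-monoˡ-≤ (8 * s) (n!≤n^n Y) ⟩
    (Y ^ Y) ^ (8 * s)       ≡⟨ cong (_^ (8 * s)) (^-*-assoc 2 (7 * s) Y) ⟩
    (2 ^ (7 * s * Y)) ^ (8 * s) ≡⟨ ^-*-assoc 2 (7 * s * Y) (8 * s) ⟩
    2 ^ (7 * s * Y * (8 * s)) ∎)
  regroup : ∀ s Y → (56 * (s * s) + 1) * Y ≡ Y + 7 * s * Y * (8 * s)
  regroup = solve-∀
  3≤Y : 3 ≤ Y
  3≤Y = ≤-trans (n<B^n ≤-refl 2) (^-monoʳ-≤ 2 (≤-trans (s≤s (s≤s z≤n)) (m≤m*n 7 s)))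
  big : 7 * s * Y * (8 * s) < n + n
  big = +-cancelˡ-< 2 _ _ (begin-strict
    2 + 7 * s * Y * (8 * s)   <⟨ +-monoˡ-≤ (7 * s * Y * (8 * s)) 3≤Y ⟩
    Y + 7 * s * Y * (8 * s)   ≡⟨ regroup s Y ⟨
    (56 * (s * s) + 1) * Y    ≤⟨ *-monoˡ-≤ Y (quadratic<exponential 14≤s) ⟩
    2 ^ s * Y                 ≡⟨ ^-distribˡ-+-* 2 s (7 * s) ⟨
    B                         ≡⟨ 2+n+n≡B ⟨
    2 + (n + n)               ∎)

-- Digits and changes of base

δ : ℕ → ℕ → ℤ
δ x y = + x ℤ.- + y

δ≡0⇒≡ : ∀ {x y} → δ x y ≡ + 0 → x ≡ y
δ≡0⇒≡ {x} {y} h = ℤ.+-injective (ℤ.i-j≡0⇒i≡j (+ x) (+ y) h)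

≡⇒δ≡0 : ∀ {x y} → x ≡ y → δ x y ≡ + 0
≡⇒δ≡0 {x} refl = ℤ.+-inverseʳ (+ x)

∣δ∣< : ∀ {L x y} → x < L → y < L → ∣ δ x y ∣ < L
∣δ∣< {L} {x} {y} x<L y<L = begin-strict
  ∣ δ x y ∣     ≡⟨ cong ∣_∣ (ℤ.[+m]-[+n]≡m⊖n x y) ⟩
  ∣ x ℤ.⊖ y ∣   ≤⟨ ℤ.∣m⊝n∣≤m⊔n x y ⟩
  x ⊔ y         <⟨ ⊔-lub x<L y<L ⟩
  L             ∎
  where open ≤-Reasoning

δ-+* : ∀ r M q r′ q′ → δ (r + M * q) (r′ + M * q′) ≡ δ r r′ ℤ.+ + M ℤ.* δ q q′
δ-+* r M q r′ q′ = begin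
  δ (r + M * q) (r′ + M * q′)
    ≡⟨ cong₂ ℤ._-_ (pos r q) (pos r′ q′) ⟩
  (+ r ℤ.+ + M ℤ.* + q) ℤ.- (+ r′ ℤ.+ + M ℤ.* + q′)
    ≡⟨ rearrange (+ r) (+ M) (+ q) (+ r′) (+ q′) ⟩
  δ r r′ ℤ.+ + M ℤ.* δ q q′ ∎
  where
  open ≡-Reasoning
  pos : ∀ r q → + (r + M * q) ≡ + r ℤ.+ + M ℤ.* + q
  pos r q = trans (ℤ.pos-+ r (M * q)) (cong (ℤ._+_ (+ r)) (ℤ.pos-* M q))
  rearrange : ∀ r M q r′ q′ → (r ℤ.+ M ℤ.* q) ℤ.- (r′ ℤ.+ M ℤ.* q′) ≡ (r ℤ.- r′) ℤ.+ M ℤ.* (q ℤ.- q′)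
  rearrange = ℤ-Solver.solve-∀

%-/-digits : ∀ s L .{{_ : NonZero L}} → s ≡ s % L + L * (s / L)
%-/-digits s L = trans (m≡m%n+[m/n]*n s L) (cong (_+_ (s % L)) (*-comm (s / L) L))

δ-%-/ : ∀ s s′ L .{{_ : NonZero L}} → δ s s′ ≡ δ (s % L) (s′ % L) ℤ.+ + L ℤ.* δ (s / L) (s′ / L)
δ-%-/ s s′ L = trans (cong₂ δ (%-/-digits s L) (%-/-digits s′ L)) (δ-+* (s % L) L (s / L) (s′ % L) (s′ / L))

small-multiple : ∀ {k i} → k ℤ.∣ i → ∣ i ∣ < ∣ k ∣ → i ≡ + 0
small-multiple {k} {i} k∣i ∣i∣<∣k∣ with ∣ i ∣ in eq
... | zero  = ℤ.∣i∣≡0⇒i≡0 eq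
... | suc m = contradiction (∣⇒≤ (subst (∣ k ∣ ∣_) eq (ℤ.∣⇒∣ᵤ k∣i))) (<⇒≱ ∣i∣<∣k∣)

m∣m*i : ∀ k i → k ℤ.∣ k ℤ.* i
m∣m*i k i = ℤ.divides i (ℤ.*-comm k i)

ℤ-coprime-divisor : ∀ {k m n} → Coprime ∣ k ∣ ∣ m ∣ → k ℤ.∣ m ℤ.* n → k ℤ.∣ n
ℤ-coprime-divisor {k} {m} {n} co k∣mn =
  ℤ.∣ᵤ⇒∣ (coprime-divisor co (subst (∣ k ∣ ∣_) (ℤ.abs-* m n) (ℤ.∣⇒∣ᵤ k∣mn)))

-- The remainders differ by a multiple of `M` that is smaller than `M`, hence by 0; the quotients
-- follow by cancellation.
%-/-unique : ∀ {M} r q r′ q′ → r < M → r′ < M → r + M * q ≡ r′ + M * q′ → r ≡ r′ × q ≡ q′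
%-/-unique {M} r q r′ q′ r<M r′<M eq = r≡r′ ,
  *-cancelˡ-≡ q q′ M {{>-nonZero (≤-<-trans z≤n r<M)}} (+-cancelˡ-≡ r _ _ (trans eq (cong (_+ M * q′) (sym r≡r′))))
  where
  total : δ r r′ ℤ.+ + M ℤ.* δ q q′ ≡ + 0
  total = trans (sym (δ-+* r M q r′ q′)) (≡⇒δ≡0 eq)
  r≡r′ : r ≡ r′
  r≡r′ = δ≡0⇒≡ (small-multiple {+ M}
    (ℤ.∣m+n∣n⇒∣m {+ M} {δ r r′} {+ M ℤ.* δ q q′} (subst (+ M ℤ.∣_) (sym total) (ℤ.divides (+ 0) refl)) (m∣m*i (+ M) (δ q q′)))
    (∣δ∣< r<M r′<M))

-- Only the lowest `n` base-`L` digits are read, whence the recurring hypothesis that numbers lie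
-- below `L ^ n`.
rebase : (L M : ℕ) .{{_ : NonZero L}} → ℕ → ℕ → ℕ
rebase L M zero    s = 0
rebase L M (suc n) s = s % L + M * rebase L M n (s / L)

rebase-< : ∀ {L M} .{{_ : NonZero L}} → L ≤ M → ∀ n s → rebase L M n s < M ^ n
rebase-< L≤M zero s = s≤s z≤n
rebase-< {L} {M} L≤M (suc n) s = begin-strict
  s % L + M * rebase L M n (s / L) <⟨ +-monoˡ-< _ (<-≤-trans (m%n<n s L) L≤M) ⟩
  M + M * rebase L M n (s / L)     ≡⟨ *-suc M _ ⟨
  M * suc (rebase L M n (s / L))   ≤⟨ *-monoʳ-≤ M (rebase-< L≤M n (s / L)) ⟩
  M * M ^ n                        ∎
  where open ≤-Reasoning

/-<-^ : ∀ {s L} .{{_ : NonZero L}} n → s < L ^ suc n → s / L < L ^ n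
/-<-^ {s} {L} n s< = m<n*o⇒m/o<n (subst (s <_) (*-comm L (L ^ n)) s<)

lin : (a b c x y z : ℕ) → ℕ
lin a b c x y z = a * x + b * y + c * z

-- Linear in the differences, so that relations between digits add up to one between numbers. As a
-- record it keeps coefficients and points visible to inference.
record Relation (α β γ : ℤ) (x y z x′ y′ z′ : ℕ) : Set where
  constructor relation
  field vanishes : α ℤ.* δ x x′ ℤ.+ β ℤ.* δ y y′ ℤ.+ γ ℤ.* δ z z′ ≡ + 0

open Relation

lin⇒Relation : ∀ {a b c} x y z x′ y′ z′ → lin a b c x y z ≡ lin a b c x′ y′ z′ →
               Relation (+ a) (+ b) (+ c) x y z x′ y′ z′
lin⇒Relation {a} {b} {c} x y z x′ y′ z′ eq = relation (begin
  + a ℤ.* δ x x′ ℤ.+ + b ℤ.* δ y y′ ℤ.+ + c ℤ.* δ z z′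
    ≡⟨ regroup (+ a) (+ b) (+ c) (+ x) (+ y) (+ z) (+ x′) (+ y′) (+ z′) ⟩
  (+ a ℤ.* + x ℤ.+ + b ℤ.* + y ℤ.+ + c ℤ.* + z) ℤ.- (+ a ℤ.* + x′ ℤ.+ + b ℤ.* + y′ ℤ.+ + c ℤ.* + z′)
    ≡⟨ cong₂ ℤ._-_ (pos x y z) (pos x′ y′ z′) ⟨
  δ (lin a b c x y z) (lin a b c x′ y′ z′)
    ≡⟨ ≡⇒δ≡0 eq ⟩
  + 0 ∎)
  where
  open ≡-Reasoning
  pos : ∀ x y z → + (lin a b c x y z) ≡ + a ℤ.* + x ℤ.+ + b ℤ.* + y ℤ.+ + c ℤ.* + z
  pos x y z = trans (ℤ.pos-+ (a * x + b * y) (c * z))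
    (cong₂ ℤ._+_ (trans (ℤ.pos-+ (a * x) (b * y)) (cong₂ ℤ._+_ (ℤ.pos-* a x) (ℤ.pos-* b y))) (ℤ.pos-* c z))
  regroup : ∀ a b c x y z x′ y′ z′ →
    a ℤ.* (x ℤ.- x′) ℤ.+ b ℤ.* (y ℤ.- y′) ℤ.+ c ℤ.* (z ℤ.- z′) ≡
    (a ℤ.* x ℤ.+ b ℤ.* y ℤ.+ c ℤ.* z) ℤ.- (a ℤ.* x′ ℤ.+ b ℤ.* y′ ℤ.+ c ℤ.* z′)
  regroup = ℤ-Solver.solve-∀

module _ {a b c L M : ℕ} .{{_ : NonZero L}} (0<a : 0 < a) (wide : (a + b + c) * L ≤ M)
         {α β γ : ℤ}
         (digit : ∀ {x y z x′ y′ z′} → x < L → y < L → z < L → x′ < L → y′ < L → z′ < L →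
                  lin a b c x y z ≡ lin a b c x′ y′ z′ → Relation α β γ x y z x′ y′ z′)
  where

  -- The absence of carries: applied to digits, `lin` yields a single digit in base `M`.
  lin-< : ∀ {x y z} → x < L → y < L → z < L → lin a b c x y z < M
  lin-< {x} {y} {z} x<L y<L z<L = begin-strict
    a * x + b * y + c * z <⟨ +-monoˡ-< (c * z) (+-monoˡ-< (b * y) (*-monoʳ-< a {{>-nonZero 0<a}} x<L)) ⟩
    a * L + b * y + c * z ≤⟨ +-mono-≤ (+-monoʳ-≤ (a * L) (*-monoʳ-≤ b (<⇒≤ y<L))) (*-monoʳ-≤ c (<⇒≤ z<L)) ⟩
    a * L + b * L + c * L ≡⟨ cong (_+ c * L) (*-distribʳ-+ L a b) ⟨
    (a + b) * L + c * L   ≡⟨ *-distribʳ-+ L (a + b) c ⟨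
    (a + b + c) * L       ≤⟨ wide ⟩
    M                     ∎
    where open ≤-Reasoning

  -- Without carries the equation splits into one for the lowest digits and one for the higher
  -- digits. The relation sought is the relation for the former plus `L` times the relation for the
  -- latter.
  rebase-Relation : ∀ n {x y z x′ y′ z′} →
    x < L ^ n → y < L ^ n → z < L ^ n → x′ < L ^ n → y′ < L ^ n → z′ < L ^ n →
    lin a b c (rebase L M n x) (rebase L M n y) (rebase L M n z) ≡
    lin a b c (rebase L M n x′) (rebase L M n y′) (rebase L M n z′) →
    Relation α β γ x y z x′ y′ z′
  rebase-Relation zero (s≤s z≤n) (s≤s z≤n) (s≤s z≤n) (s≤s z≤n) (s≤s z≤n) (s≤s z≤n) _ = relation (zeros α β γ)
    where
    zeros : ∀ α β γ → α ℤ.* + 0 ℤ.+ β ℤ.* + 0 ℤ.+ γ ℤ.* + 0 ≡ + 0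
    zeros = ℤ-Solver.solve-∀
  rebase-Relation (suc n) {x} {y} {z} {x′} {y′} {z′} x< y< z< x′< y′< z′< eq = relation (begin
    α ℤ.* δ x x′ ℤ.+ β ℤ.* δ y y′ ℤ.+ γ ℤ.* δ z z′
      ≡⟨ cong₂ ℤ._+_ (cong₂ (λ i j → α ℤ.* i ℤ.+ β ℤ.* j) (δ-%-/ x x′ L) (δ-%-/ y y′ L)) (cong (γ ℤ.*_) (δ-%-/ z z′ L)) ⟩
    α ℤ.* (δ₀ x x′ ℤ.+ + L ℤ.* δ₁ x x′) ℤ.+ β ℤ.* (δ₀ y y′ ℤ.+ + L ℤ.* δ₁ y y′) ℤ.+ γ ℤ.* (δ₀ z z′ ℤ.+ + L ℤ.* δ₁ z z′)
      ≡⟨ regroup α β γ (+ L) (δ₀ x x′) (δ₁ x x′) (δ₀ y y′) (δ₁ y y′) (δ₀ z z′) (δ₁ z z′) ⟩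
    (α ℤ.* δ₀ x x′ ℤ.+ β ℤ.* δ₀ y y′ ℤ.+ γ ℤ.* δ₀ z z′) ℤ.+ + L ℤ.* (α ℤ.* δ₁ x x′ ℤ.+ β ℤ.* δ₁ y y′ ℤ.+ γ ℤ.* δ₁ z z′)
      ≡⟨ cong₂ (λ i j → i ℤ.+ + L ℤ.* j)
           (vanishes (digit (m%n<n x L) (m%n<n y L) (m%n<n z L) (m%n<n x′ L) (m%n<n y′ L) (m%n<n z′ L) (proj₁ separate)))
           (vanishes (rebase-Relation n (/-<-^ n x<) (/-<-^ n y<) (/-<-^ n z<) (/-<-^ n x′<) (/-<-^ n y′<) (/-<-^ n z′<) (proj₂ separate))) ⟩
    + 0 ℤ.+ + L ℤ.* + 0
      ≡⟨ trans (ℤ.+-identityˡ _) (ℤ.*-zeroʳ (+ L)) ⟩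
    + 0 ∎)
    where
    open ≡-Reasoning
    δ₀ δ₁ : ℕ → ℕ → ℤ
    δ₀ s s′ = δ (s % L) (s′ % L)
    δ₁ s s′ = δ (s / L) (s′ / L)
    ρ = λ s → rebase L M n (s / L)
    regroup : ∀ α β γ L d₁ q₁ d₂ q₂ d₃ q₃ →
      α ℤ.* (d₁ ℤ.+ L ℤ.* q₁) ℤ.+ β ℤ.* (d₂ ℤ.+ L ℤ.* q₂) ℤ.+ γ ℤ.* (d₃ ℤ.+ L ℤ.* q₃) ≡
      (α ℤ.* d₁ ℤ.+ β ℤ.* d₂ ℤ.+ γ ℤ.* d₃) ℤ.+ L ℤ.* (α ℤ.* q₁ ℤ.+ β ℤ.* q₂ ℤ.+ γ ℤ.* q₃)
    regroup = ℤ-Solver.solve-∀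
    split : ∀ a b c M x y z x₁ y₁ z₁ → a * (x + M * x₁) + b * (y + M * y₁) + c * (z + M * z₁) ≡
                                       (a * x + b * y + c * z) + M * (a * x₁ + b * y₁ + c * z₁)
    split = solve-∀
    separate : lin a b c (x % L) (y % L) (z % L) ≡ lin a b c (x′ % L) (y′ % L) (z′ % L) ×
               lin a b c (ρ x) (ρ y) (ρ z) ≡ lin a b c (ρ x′) (ρ y′) (ρ z′)
    separate = %-/-unique _ _ _ _
      (lin-< (m%n<n x L) (m%n<n y L) (m%n<n z L)) (lin-< (m%n<n x′ L) (m%n<n y′ L) (m%n<n z′ L))
      (trans (sym (split a b c M (x % L) (y % L) (z % L) (ρ x) (ρ y) (ρ z)))
        (trans eq (split a b c M (x′ % L) (y′ % L) (z′ % L) (ρ x′) (ρ y′) (ρ z′))))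

-- Sidon sets

%≡⇒∣δ : ∀ {m n} p .{{_ : NonZero p}} → m % p ≡ n % p → + p ℤ.∣ δ m n
%≡⇒∣δ {m} {n} p eq = subst (+ p ℤ.∣_) (sym (trans (δ-%-/ m n p)
    (trans (cong (ℤ._+ + p ℤ.* δ (m / p) (n / p)) (≡⇒δ≡0 eq)) (ℤ.+-identityˡ _))))
  (m∣m*i (+ p) (δ (m / p) (n / p)))

%-sum : ∀ m n m′ n′ p .{{_ : NonZero p}} → m % p + n % p ≡ m′ % p + n′ % p →
        + p ℤ.∣ δ (m + n) (m′ + n′)
%-sum m n m′ n′ p eq = %≡⇒∣δ p
  (trans (%-distribˡ-+ m n p) (trans (cong (_% p) eq) (sym (%-distribˡ-+ m′ n′ p))))

-- The factor `2 * p` leaves room for the sum of two residues, so a sum of two values can be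
-- separated into its two parts.
erdős-turán : (p : ℕ) .{{_ : NonZero p}} → ℕ → ℕ
erdős-turán p x = (x * x) % p + (2 * p) * x

erdős-turán-< : ∀ {p} .{{_ : NonZero p}} {x} → x < p → erdős-turán p x < (2 * p) * p
erdős-turán-< {p} {x} x<p = begin-strict
  (x * x) % p + (2 * p) * x <⟨ +-monoˡ-< ((2 * p) * x) (<-≤-trans (m%n<n (x * x) p) (m≤n*m p 2)) ⟩
  2 * p + (2 * p) * x       ≡⟨ *-suc (2 * p) x ⟨
  (2 * p) * suc x           ≤⟨ *-monoʳ-≤ (2 * p) x<p ⟩
  (2 * p) * p               ∎
  where open ≤-Reasoning

-- The sum determines `x + y` exactly and `x² + y²` modulo `p`. Given `x + y = x′ + y′`, the sums of
-- squares differ by `2 (x − x′)(x − y′)`. The odd prime `p` divides one of the two differences,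
-- which is smaller than `p` and so vanishes.
erdős-turán-sidon : ∀ {p} .{{_ : NonZero p}} → Prime p → 2 < p →
  ∀ {x y x′ y′} → x < p → y < p → x′ < p → y′ < p →
  erdős-turán p x + erdős-turán p y ≡ erdős-turán p x′ + erdős-turán p y′ →
  (x ≡ x′ × y ≡ y′) ⊎ (x ≡ y′ × y ≡ x′)
erdős-turán-sidon {p} pp 2<p {x} {y} {x′} {y′} x<p y<p x′<p y′<p eq = cases
  where
  collect : ∀ r s m x y → (r + m * x) + (s + m * y) ≡ (r + s) + m * (x + y)
  collect = solve-∀
  r+s<2p : ∀ m n → m % p + n % p < 2 * p
  r+s<2p m n = subst (m % p + n % p <_) (cong (_+_ p) (sym (+-identityʳ p))) (+-mono-< (m%n<n m p) (m%n<n n p))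
  separate : (x * x) % p + (y * y) % p ≡ (x′ * x′) % p + (y′ * y′) % p × x + y ≡ x′ + y′
  separate = %-/-unique {2 * p} ((x * x) % p + (y * y) % p) (x + y) ((x′ * x′) % p + (y′ * y′) % p) (x′ + y′) (r+s<2p (x * x) (y * y)) (r+s<2p (x′ * x′) (y′ * y′))
    (trans (sym (collect ((x * x) % p) ((y * y) % p) (2 * p) x y))
      (trans eq (collect ((x′ * x′) % p) ((y′ * y′) % p) (2 * p) x′ y′)))
  squares : + p ℤ.∣ δ (x * x + y * y) (x′ * x′ + y′ * y′)
  squares = %-sum (x * x) (y * y) (x′ * x′) (y′ * y′) p (proj₁ separate)
  sum≡0 : δ (x + y) (x′ + y′) ≡ + 0
  sum≡0 = ≡⇒δ≡0 (proj₂ separate)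
  pos : ∀ x y → + (x * x + y * y) ≡ + x ℤ.* + x ℤ.+ + y ℤ.* + y
  pos x y = trans (ℤ.pos-+ (x * x) (y * y)) (cong₂ ℤ._+_ (ℤ.pos-* x x) (ℤ.pos-* y y))
  identity : ∀ X Y X′ Y′ → (X ℤ.* X ℤ.+ Y ℤ.* Y) ℤ.- (X′ ℤ.* X′ ℤ.+ Y′ ℤ.* Y′) ≡
    + 2 ℤ.* ((X ℤ.- X′) ℤ.* (X ℤ.- Y′)) ℤ.+ ((X ℤ.+ Y) ℤ.- (X′ ℤ.+ Y′)) ℤ.* (Y ℤ.- X ℤ.+ X′ ℤ.+ Y′)
  identity = ℤ-Solver.solve-∀
  factored : δ (x * x + y * y) (x′ * x′ + y′ * y′) ≡ + 2 ℤ.* (δ x x′ ℤ.* δ x y′)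
  factored = begin
    δ (x * x + y * y) (x′ * x′ + y′ * y′)
      ≡⟨ cong₂ ℤ._-_ (pos x y) (pos x′ y′) ⟩
    (+ x ℤ.* + x ℤ.+ + y ℤ.* + y) ℤ.- (+ x′ ℤ.* + x′ ℤ.+ + y′ ℤ.* + y′)
      ≡⟨ identity (+ x) (+ y) (+ x′) (+ y′) ⟩
    + 2 ℤ.* (δ x x′ ℤ.* δ x y′) ℤ.+ δ (x + y) (x′ + y′) ℤ.* (+ y ℤ.- + x ℤ.+ + x′ ℤ.+ + y′)
      ≡⟨ cong (λ i → + 2 ℤ.* (δ x x′ ℤ.* δ x y′) ℤ.+ i ℤ.* (+ y ℤ.- + x ℤ.+ + x′ ℤ.+ + y′)) sum≡0 ⟩
    + 2 ℤ.* (δ x x′ ℤ.* δ x y′) ℤ.+ + 0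
      ≡⟨ ℤ.+-identityʳ _ ⟩
    + 2 ℤ.* (δ x x′ ℤ.* δ x y′) ∎
    where open ≡-Reasoning
  divides-product : p ∣ 2 * (∣ δ x x′ ∣ * ∣ δ x y′ ∣)
  divides-product = subst (p ∣_) (trans (ℤ.abs-* (+ 2) (δ x x′ ℤ.* δ x y′)) (cong (2 *_) (ℤ.abs-* (δ x x′) (δ x y′))))
    (ℤ.∣⇒∣ᵤ (subst (+ p ℤ.∣_) factored squares))
  vanish : ∀ {s t} → s < p → t < p → p ∣ ∣ δ s t ∣ → s ≡ t
  vanish {s} {t} s<p t<p h = δ≡0⇒≡ (small-multiple {+ p} (ℤ.∣ᵤ⇒∣ h) (∣δ∣< s<p t<p))
  cases : (x ≡ x′ × y ≡ y′) ⊎ (x ≡ y′ × y ≡ x′)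
  cases = [ (λ p∣2 → contradiction (∣⇒≤ p∣2) (<⇒≱ 2<p))
          , (λ h → [ first , second ]′ (euclidsLemma ∣ δ x x′ ∣ ∣ δ x y′ ∣ pp h)) ]′
          (euclidsLemma 2 (∣ δ x x′ ∣ * ∣ δ x y′ ∣) pp divides-product)
    where
    first : p ∣ ∣ δ x x′ ∣ → (x ≡ x′ × y ≡ y′) ⊎ (x ≡ y′ × y ≡ x′)
    first h = let x≡x′ = vanish x<p x′<p h in
      inj₁ (x≡x′ , +-cancelˡ-≡ x′ y y′ (trans (cong (_+ y) (sym x≡x′)) (proj₂ separate)))
    second : p ∣ ∣ δ x y′ ∣ → (x ≡ x′ × y ≡ y′) ⊎ (x ≡ y′ × y ≡ x′)
    second h = let x≡y′ = vanish x<p y′<p h in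
      inj₂ (x≡y′ , +-cancelˡ-≡ y′ y x′ (trans (cong (_+ y) (sym x≡y′)) (trans (proj₂ separate) (+-comm x′ y′))))

-- The set is enumerated by `e` below `K`. Since the conclusion concerns indices, `e` is injective
-- there.
Sidon : ℕ → (ℕ → ℕ) → Set
Sidon K e = ∀ {x y x′ y′} → x < K → y < K → x′ < K → y′ < K →
  e x + e y ≡ e x′ + e y′ → (x ≡ x′ × y ≡ y′) ⊎ (x ≡ y′ × y ≡ x′)

[2^km]^n : ∀ k m n → (2 ^ (k * m)) ^ n ≡ (2 ^ (n * m)) ^ k
[2^km]^n k m n = trans (^-*-assoc 2 (k * m) n) (trans (cong (2 ^_) (swap k m n)) (sym (^-*-assoc 2 (n * m) k)))
  where
  swap : ∀ k m n → k * m * n ≡ n * m * k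
  swap = solve-∀

-- The exponent 7/16 falls short of 1/2 only because of the crude prime gap.
sidon-family : ∃[ C ] ∀ X → 1 ≤ X → ∃[ K ] ∃[ e ]
  ((∀ {i} → i < K → e i < X) × X ^ 7 ≤ (C * K) ^ 16 × Sidon K e)
-- This constant makes one-element sets large enough as long as `X < 2 ^ (16 * 15)`.
sidon-family = 2 ^ (7 * 15) , build (2 ^ (7 * 15)) (λ m m≤15 → ^-monoʳ-≤ 2 {7 * m} {7 * 15} (*-monoʳ-≤ 7 m≤15))
  where
  open ≤-Reasoning
  size : ∀ {X} m C K → X < 2 ^ (16 * m) → 2 ^ (7 * m) ≤ C * K → X ^ 7 ≤ (C * K) ^ 16
  size {X} m C K X< h = begin
    X ^ 7                  ≤⟨ ^-monoˡ-≤ 7 (<⇒≤ X<) ⟩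
    (2 ^ (16 * m)) ^ 7     ≡⟨ [2^km]^n 16 m 7 ⟩
    (2 ^ (7 * m)) ^ 16     ≤⟨ ^-monoˡ-≤ 16 h ⟩
    (C * K) ^ 16           ∎
  build : ∀ C → (∀ m → m ≤ 15 → 2 ^ (7 * m) ≤ C) → ∀ X → 1 ≤ X → ∃[ K ] ∃[ e ]
    ((∀ {i} → i < K → e i < X) × X ^ 7 ≤ (C * K) ^ 16 × Sidon K e)
  build C C≥ X 1≤X
    with bracket (λ k → 2 ^ (16 * k)) X X 1≤X (<-≤-trans (n<B^n ≤-refl X) (^-monoʳ-≤ 2 (m≤n*m X 16)))
  ... | m , low , high with 15 ≤? m
  ...   | no m<15 = 1 , (λ _ → 0) , (λ _ → 1≤X)
          , size (suc m) C 1 high (≤-trans (C≥ (suc m) (≰⇒> m<15)) ((≤-reflexive (sym (*-identityʳ C)))))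
          , λ { (s≤s z≤n) (s≤s z≤n) (s≤s z≤n) (s≤s z≤n) _ → inj₁ (refl , refl) }
  -- Here `m = suc s`. The set lies below `2 p² ≤ 2 ^ (16 s + 1) ≤ X`, while `p > 2 ^ (7 s)` misses
  -- `2 ^ (7 (s + 2))` by a factor below `2 ^ 14 ≤ C`.
  ...   | yes (s≤s {n = s} 14≤s) with prime-between s 14≤s
  ...     | p , pp , p> , p≤ = p , erdős-turán p , (λ i<p → <-≤-trans (erdős-turán-< i<p) fits)
          , size (suc (suc s)) C p high large , erdős-turán-sidon pp 2<p
    where
    instance _ = prime⇒nonZero pp
    2<p : 2 < p
    2<p = <-trans (n<B^n ≤-refl 2) (≤-<-trans (^-monoʳ-≤ 2 (≤-trans (s≤s (s≤s z≤n)) (≤-trans 14≤s (m≤n*m s 7)))) p>)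
    fits : 2 * p * p ≤ X
    fits = begin
      2 * p * p                         ≡⟨ *-assoc 2 p p ⟩
      2 * (p * p)                       ≤⟨ *-monoʳ-≤ 2 (*-mono-≤ p≤ p≤) ⟩
      2 * (2 ^ (8 * s) * 2 ^ (8 * s))   ≡⟨ cong (2 *_) (^-distribˡ-+-* 2 (8 * s) (8 * s)) ⟨
      2 ^ suc (8 * s + 8 * s)           ≤⟨ ^-monoʳ-≤ 2 (≤-trans (m≤m+n _ 15) (≤-reflexive (expand s))) ⟩
      2 ^ (16 * suc s)                  ≤⟨ low ⟩
      X                                 ∎
      where
      expand : ∀ s → suc (8 * s + 8 * s) + 15 ≡ 16 * suc s
      expand = solve-∀
    large : 2 ^ (7 * suc (suc s)) ≤ C * p
    large = begin
      2 ^ (7 * suc (suc s))       ≡⟨ split 2 s ⟩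
      2 ^ (7 * 2) * 2 ^ (7 * s)   ≤⟨ *-mono-≤ (C≥ 2 (s≤s (s≤s z≤n))) (<⇒≤ p>) ⟩
      C * p                       ∎
      where
      split : ∀ k s → 2 ^ (7 * (k + s)) ≡ 2 ^ (7 * k) * 2 ^ (7 * s)
      split k s = trans (cong (2 ^_) (*-distribˡ-+ 7 k s)) (^-distribˡ-+-* 2 (7 * k) (7 * s))

-- Sets without proportional differences

-- In base v² with digits below ∣ v ∣, divisibility by v kills first the lowest digit
-- of y − y′ and then that of x − x′.
coprime-rebase : ∀ {v u} .{{_ : NonZero ∣ v ∣}} .{{_ : ℤ.NonZero v}} → Coprime ∣ v ∣ ∣ u ∣ →
  let q = ∣ v ∣; ρ = rebase q (q * q) in
  ∀ k {x x′ y y′} → x < q ^ k → x′ < q ^ k → y < q ^ k → y′ < q ^ k →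
  v ℤ.* δ (ρ k x) (ρ k x′) ≡ u ℤ.* δ (ρ k y) (ρ k y′) → x ≡ x′ × y ≡ y′
coprime-rebase co zero (s≤s z≤n) (s≤s z≤n) (s≤s z≤n) (s≤s z≤n) _ = refl , refl
coprime-rebase {v} {u} co (suc k) {x} {x′} {y} {y′} x< x′< y< y′< eq =
  glue x x′ d₀≡0 (proj₁ quotients) , glue y y′ e₀≡0 (proj₂ quotients)
  where
  open ≡-Reasoning
  q = ∣ v ∣
  r : ℕ → ℕ
  r s = rebase q (q * q) k (s / q)
  d₀ = δ (x % q) (x′ % q)
  e₀ = δ (y % q) (y′ % q)
  D = δ (r x) (r x′)
  E = δ (r y) (r y′)
  square : ∀ i → + (∣ i ∣ * ∣ i ∣) ≡ i ℤ.* i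
  square (+ n)     = ℤ.pos-* n n
  square ℤ.-[1+ n ] = refl
  expand : ∀ s s′ → δ (rebase q (q * q) (suc k) s) (rebase q (q * q) (suc k) s′) ≡
                    δ (s % q) (s′ % q) ℤ.+ v ℤ.* v ℤ.* δ (r s) (r s′)
  expand s s′ = trans (δ-+* (s % q) (q * q) (r s) (s′ % q) (r s′))
                      (cong (λ m → δ (s % q) (s′ % q) ℤ.+ m ℤ.* δ (r s) (r s′)) (square v))
  expanded : v ℤ.* (d₀ ℤ.+ v ℤ.* v ℤ.* D) ≡ u ℤ.* (e₀ ℤ.+ v ℤ.* v ℤ.* E)
  expanded = trans (cong (v ℤ.*_) (sym (expand x x′))) (trans eq (cong (u ℤ.*_) (expand y y′)))
  digit-vanishes : ∀ {i} s s′ → v ℤ.∣ δ (s % q) (s′ % q) ℤ.+ v ℤ.* v ℤ.* i → δ (s % q) (s′ % q) ≡ + 0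
  digit-vanishes {i} s s′ h = small-multiple {v} {δ (s % q) (s′ % q)}
    (ℤ.∣m+n∣n⇒∣m h (subst (v ℤ.∣_) (sym (ℤ.*-assoc v v i)) (m∣m*i v (v ℤ.* i))))
    (∣δ∣< (m%n<n s q) (m%n<n s′ q))
  e₀≡0 : e₀ ≡ + 0
  e₀≡0 = digit-vanishes {E} y y′ (ℤ-coprime-divisor {v} {u} co
    (subst (v ℤ.∣_) expanded (m∣m*i v (d₀ ℤ.+ v ℤ.* v ℤ.* D))))
  once : d₀ ℤ.+ v ℤ.* v ℤ.* D ≡ v ℤ.* (u ℤ.* E)
  once = ℤ.*-cancelˡ-≡ v _ _ (trans expanded (trans
    (cong (λ i → u ℤ.* (i ℤ.+ v ℤ.* v ℤ.* E)) e₀≡0) (rearrange u v E)))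
    where
    rearrange : ∀ u v E → u ℤ.* (+ 0 ℤ.+ v ℤ.* v ℤ.* E) ≡ v ℤ.* (v ℤ.* (u ℤ.* E))
    rearrange = ℤ-Solver.solve-∀
  d₀≡0 : d₀ ≡ + 0
  d₀≡0 = digit-vanishes {D} x x′ (subst (v ℤ.∣_) (sym once) (m∣m*i v (u ℤ.* E)))
  -- The second division by `v` restores the original equation for the higher digits.
  twice : v ℤ.* D ≡ u ℤ.* E
  twice = ℤ.*-cancelˡ-≡ v _ _ (begin
    v ℤ.* (v ℤ.* D)         ≡⟨ ℤ.*-assoc v v D ⟨
    v ℤ.* v ℤ.* D           ≡⟨ ℤ.+-identityˡ _ ⟨
    + 0 ℤ.+ v ℤ.* v ℤ.* D   ≡⟨ cong (ℤ._+ v ℤ.* v ℤ.* D) d₀≡0 ⟨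
    d₀ ℤ.+ v ℤ.* v ℤ.* D    ≡⟨ once ⟩
    v ℤ.* (u ℤ.* E)         ∎)
  quotients : x / q ≡ x′ / q × y / q ≡ y′ / q
  quotients = coprime-rebase {v} {u} co k (/-<-^ k x<) (/-<-^ k x′<) (/-<-^ k y<) (/-<-^ k y′<) twice
  glue : ∀ s s′ → δ (s % q) (s′ % q) ≡ + 0 → s / q ≡ s′ / q → s ≡ s′
  glue s s′ h eq′ = trans (%-/-digits s q)
    (trans (cong₂ (λ m n → m + q * n) (δ≡0⇒≡ h) eq′) (sym (%-/-digits s′ q)))

Independent : (v u : ℤ) → ℕ → (ℕ → ℕ) → Set
Independent v u K e = ∀ {x x′ y y′} → x < K → x′ < K → y < K → y′ < K →
  v ℤ.* δ (e x) (e x′) ≡ u ℤ.* δ (e y) (e y′) → x ≡ x′ × y ≡ y′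

IndependentFamily : (v u : ℤ) → Set
IndependentFamily v u = ∃[ C ] ∀ X → 1 ≤ X → ∃[ K ] ∃[ e ]
  ((∀ {i} → i < K → e i < X) × X ≤ (C * K) ^ 2 × Independent v u K e)

-- Rebasing places `q ^ k` numbers below `(q * q) ^ k`. Rounding `X` down to a power of `q * q`
-- costs the constant `q`.
coprime-family : ∀ {v u} → 2 ≤ ∣ v ∣ → Coprime ∣ v ∣ ∣ u ∣ → IndependentFamily v u
coprime-family {v} {u} 2≤q co = q , family
  where
  q = ∣ v ∣
  instance
    _ : NonZero q
    _ = >-nonZero (≤-trans (s≤s z≤n) 2≤q)
    _ : ℤ.NonZero v
    _ = ℤ.≢-nonZero {v} (λ { refl → contradiction 2≤q λ () })
  swap : ∀ q Q → q * q * (Q * Q) ≡ q * Q * (q * Q * 1)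
  swap = solve-∀
  family : ∀ X → 1 ≤ X → ∃[ K ] ∃[ e ]
    ((∀ {i} → i < K → e i < X) × X ≤ (q * K) ^ 2 × Independent v u K e)
  family X 1≤X with log-bracket {q * q} (≤-trans 2≤q (m≤m*n q q)) 1≤X
  ... | k , low , high = q ^ k , rebase q (q * q) k
      , (λ {i} _ → <-≤-trans (rebase-< (m≤m*n q q) k i) low)
      , ≤-trans (<⇒≤ high) (≤-reflexive (trans (cong (q * q *_) (^-distribʳ-* k q q)) (swap q (q ^ k))))
      , coprime-rebase {v} {u} co k

scaled-family : ∀ {v u g} .{{_ : ℤ.NonZero g}} → IndependentFamily v u → IndependentFamily (v ℤ.* g) (u ℤ.* g)
scaled-family {v} {u} {g} (C , family) = C , λ X 1≤X → case (family X 1≤X)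
  where
  pull : ∀ v g i → v ℤ.* g ℤ.* i ≡ g ℤ.* (v ℤ.* i)
  pull = ℤ-Solver.solve-∀
  case : ∀ {X} → ∃[ K ] ∃[ e ] ((∀ {i} → i < K → e i < X) × X ≤ (C * K) ^ 2 × Independent v u K e) →
         ∃[ K ] ∃[ e ] ((∀ {i} → i < K → e i < X) × X ≤ (C * K) ^ 2 × Independent (v ℤ.* g) (u ℤ.* g) K e)
  case (K , e , e< , X≤ , ind) = K , e , e< , X≤ , λ {x} {x′} {y} {y′} x< x′< y< y′< eq →
    ind x< x′< y< y′< (ℤ.*-cancelˡ-≡ g _ _
      (trans (sym (pull v g (δ (e x) (e x′)))) (trans eq (pull u g (δ (e y) (e y′))))))

swapped-family : ∀ {v u} → IndependentFamily v u → IndependentFamily u v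
swapped-family (C , family) = C , λ X 1≤X →
  let K , e , e< , X≤ , ind = family X 1≤X in
  K , e , e< , X≤ , λ x< x′< y< y′< eq → let y≡y′ , x≡x′ = ind y< y′< x< x′< (sym eq) in x≡x′ , y≡y′

-- Division by the gcd makes the pair coprime. As `∣ v′ ∣ > ∣ u′ ∣ ≥ 1`, the base `∣ v′ ∣` is at
-- least 2.
larger-family : ∀ {v u} → u ≢ + 0 → ∣ u ∣ < ∣ v ∣ → IndependentFamily v u
larger-family {v} {u} u≢0 u<v = subst₂ IndependentFamily (sym v≡) (sym u≡)
  (scaled-family {v′} {u′} {+ g} (coprime-family {v′} {u′} 2≤v′ co))
  where
  g = gcd ∣ v ∣ ∣ u ∣
  instance
    _ : NonZero ∣ u ∣
    _ = ≢-nonZero (λ h → u≢0 (ℤ.∣i∣≡0⇒i≡0 h))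
    _ : NonZero g
    _ = ≢-nonZero (gcd[m,n]≢0 ∣ v ∣ ∣ u ∣ (inj₂ (≢-nonZero⁻¹ ∣ u ∣)))
    _ : ℤ.NonZero (+ g)
    _ = ℤ.≢-nonZero {+ g} (λ h → ≢-nonZero⁻¹ g (ℤ.+-injective h))
  g∣v : + g ℤ.∣ v
  g∣v = ℤ.∣ᵤ⇒∣ (gcd[m,n]∣m ∣ v ∣ ∣ u ∣)
  g∣u : + g ℤ.∣ u
  g∣u = ℤ.∣ᵤ⇒∣ (gcd[m,n]∣n ∣ v ∣ ∣ u ∣)
  v′ = ℤ.quotient g∣v
  u′ = ℤ.quotient g∣u
  v≡ : v ≡ v′ ℤ.* + g
  v≡ = ℤ._∣_.equality g∣v
  u≡ : u ≡ u′ ℤ.* + g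
  u≡ = ℤ._∣_.equality g∣u
  ∣v∣≡ : ∣ v ∣ ≡ ∣ v′ ∣ * g
  ∣v∣≡ = trans (cong ∣_∣ v≡) (ℤ.abs-* v′ (+ g))
  ∣u∣≡ : ∣ u ∣ ≡ ∣ u′ ∣ * g
  ∣u∣≡ = trans (cong ∣_∣ u≡) (ℤ.abs-* u′ (+ g))
  quotient≡ : ∀ {m n} → m ≡ n * g → m / g ≡ n
  quotient≡ {n = n} eq = trans (cong (_/ g) eq) (m*n/n≡m n g)
  co : Coprime ∣ v′ ∣ ∣ u′ ∣
  co = subst₂ Coprime (quotient≡ ∣v∣≡) (quotient≡ ∣u∣≡) (coprime-/gcd ∣ v ∣ ∣ u ∣)
  2≤v′ : 2 ≤ ∣ v′ ∣
  2≤v′ = ≤-trans (s≤s (n≢0⇒n>0 (λ h → ≢-nonZero⁻¹ ∣ u ∣ (trans ∣u∣≡ (cong (_* g) h)))))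
    (*-cancelʳ-< g ∣ u′ ∣ ∣ v′ ∣ (subst₂ _<_ ∣u∣≡ ∣v∣≡ u<v))

independent-family : ∀ {v u} → v ≢ + 0 → u ≢ + 0 → ∣ v ∣ ≢ ∣ u ∣ → IndependentFamily v u
independent-family {v} {u} v≢0 u≢0 v≢u with <-cmp ∣ v ∣ ∣ u ∣
... | tri< v<u _ _ = swapped-family {u} {v} (larger-family {u} {v} v≢0 v<u)
... | tri≈ _ v≡u _ = contradiction v≡u v≢u
... | tri> _ _ u<v = larger-family {v} {u} u≢0 u<v

-- From a family of index sets to the conclusion

-- The second alternative exchanges two variables with equal coefficients; it arises in the Sidon
-- case.
Matched : (a b x y z x′ y′ z′ : ℕ) → Set
Matched a b x y z x′ y′ z′ = (x ≡ x′ × y ≡ y′ × z ≡ z′) ⊎ (a ≡ b × x ≡ y′ × y ≡ x′ × z ≡ z′)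

-- The coefficients cancel in pairs as a formal identity in the indicators, so coincidences among
-- the values of `f` do no harm.
matched⇒trivial : ∀ {a b c x y z x′ y′ z′} (f : ℕ → ℕ) → Matched a b x y z x′ y′ z′ →
  Trivial a b c (f x) (f y) (f z) (f x′) (f y′) (f z′)
matched⇒trivial {a} {b} {c} {x} {y} {z} f (inj₁ (refl , refl , refl)) α =
  cancel (+ a) (+ b) (+ c) (ind α (f x)) (ind α (f y)) (ind α (f z))
  where
  cancel : ∀ a b c i j k → a ℤ.* i ℤ.+ b ℤ.* j ℤ.+ c ℤ.* k ℤ.- a ℤ.* i ℤ.- b ℤ.* j ℤ.- c ℤ.* k ≡ + 0
  cancel = ℤ-Solver.solve-∀
matched⇒trivial {a} {b} {c} {x} {y} {z} f (inj₂ (refl , refl , refl , refl)) α =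
  cancel (+ a) (+ c) (ind α (f x)) (ind α (f y)) (ind α (f z))
  where
  cancel : ∀ a c i j k → a ℤ.* i ℤ.+ a ℤ.* j ℤ.+ c ℤ.* k ℤ.- a ℤ.* j ℤ.- a ℤ.* i ℤ.- c ℤ.* k ≡ + 0
  cancel = ℤ-Solver.solve-∀

-- The inequality is `length A ≥ (p / q) N ^ (E / F)` with fractions and roots cleared.
Conclusion : (E F a b c : ℕ) → Set
Conclusion E F a b c = ∃[ p ] ∃[ q ] (0 < p × 0 < q ×
  (∀ (N : ℕ) → 0 < N →
    ∃[ A ] (Unique A × All (λ x → 1 ≤ x × x ≤ N) A ×
      p ^ F * N ^ E ≤ q ^ F * length A ^ F ×
      (∀ {x y z x′ y′ z′} → x ∈ A → y ∈ A → z ∈ A → x′ ∈ A → y′ ∈ A → z′ ∈ A →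
        a * x + b * y + c * z ≡ a * x′ + b * y′ + c * z′ →
        Trivial a b c x y z x′ y′ z′))))

^-^-comm : ∀ x m n → (x ^ m) ^ n ≡ (x ^ n) ^ m
^-^-comm x m n = trans (^-*-assoc x m n) (trans (cong (x ^_) (*-comm m n)) (sym (^-*-assoc x n m)))

-- In real exponents: `M ^ (E / F) ≤ L ^ (α / β)`, and `C K` is at least `(L ^ n) ^ (α / β)`. Both
-- are combined as `β`-th powers.
density : ∀ {L M C K} E F α β .{{_ : NonZero β}} n → M ^ (E * β) ≤ L ^ (F * α) →
          (L ^ n) ^ α ≤ (C * K) ^ β → (M ^ n) ^ E ≤ (C * K) ^ F
density {L} {M} {C} {K} E F α β n sparse dense = ^-cancelˡ-≤ β (begin
  ((M ^ n) ^ E) ^ β     ≡⟨ ^-*-assoc (M ^ n) E β ⟩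
  (M ^ n) ^ (E * β)     ≡⟨ ^-^-comm M n (E * β) ⟩
  (M ^ (E * β)) ^ n     ≤⟨ ^-monoˡ-≤ n sparse ⟩
  (L ^ (F * α)) ^ n     ≡⟨ ^-^-comm L (F * α) n ⟩
  (L ^ n) ^ (F * α)     ≡⟨ cong ((L ^ n) ^_) (*-comm F α) ⟩
  (L ^ n) ^ (α * F)     ≡⟨ ^-*-assoc (L ^ n) α F ⟨
  ((L ^ n) ^ α) ^ F     ≤⟨ ^-monoˡ-≤ F dense ⟩
  ((C * K) ^ β) ^ F     ≡⟨ ^-^-comm (C * K) β F ⟩
  ((C * K) ^ F) ^ β     ∎)
  where open ≤-Reasoning

-- As `N` may come close to `M ^ suc n`, a factor `M ^ E` is lost; the denominator absorbs it as
-- `M ^ F`.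
density-at : ∀ {M C K N} .{{_ : NonZero M}} E F n → E ≤ F → N < M ^ suc n → (M ^ n) ^ E ≤ (C * K) ^ F →
             1 ^ F * N ^ E ≤ (M * C) ^ F * K ^ F
density-at {M} {C} {K} {N} E F n E≤F N< h = begin
  1 ^ F * N ^ E           ≡⟨ cong (_* N ^ E) (^-zeroˡ F) ⟩
  1 * N ^ E               ≡⟨ *-identityˡ (N ^ E) ⟩
  N ^ E                   ≤⟨ ^-monoˡ-≤ E (<⇒≤ N<) ⟩
  (M * M ^ n) ^ E         ≡⟨ ^-distribʳ-* E M (M ^ n) ⟩
  M ^ E * (M ^ n) ^ E     ≤⟨ *-mono-≤ (^-monoʳ-≤ M E≤F) h ⟩
  M ^ F * (C * K) ^ F     ≡⟨ ^-distribʳ-* F M (C * K) ⟨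
  (M * (C * K)) ^ F       ≡⟨ cong (_^ F) (*-assoc M C K) ⟨
  (M * C * K) ^ F         ≡⟨ ^-distribʳ-* F (M * C) K ⟩
  (M * C) ^ F * K ^ F     ∎
  where open ≤-Reasoning

SolutionFree : (a b c K : ℕ) → (ℕ → ℕ) → Set
SolutionFree a b c K f = ∀ {x y z x′ y′ z′} → x < K → y < K → z < K → x′ < K → y′ < K → z′ < K →
  lin a b c (f x) (f y) (f z) ≡ lin a b c (f x′) (f y′) (f z′) → Matched a b x y z x′ y′ z′

module _ {a b c L C : ℕ} .{{_ : NonZero L}} (E F α β : ℕ) .{{_ : NonZero β}} where

  private
    M : ℕ
    M = (a + b + c) * L

  conclude : 0 < a → 0 < b → 0 < C → E ≤ F → M ^ (E * β) ≤ L ^ (F * α) →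
    (∀ n → ∃[ K ] Σ (ℕ → ℕ) λ e → ((∀ {i} → i < K → e i < L ^ n) × (L ^ n) ^ α ≤ (C * K) ^ β ×
      SolutionFree a b c K (λ i → rebase L M n (e i)))) →
    Conclusion E F a b c
  conclude 0<a 0<b 0<C E≤F sparse family =
    1 , M * C , s≤s z≤n , *-mono-≤ (≤-trans (s≤s z≤n) 2≤M) 0<C , sets
    where
    2≤a+b+c : 2 ≤ a + b + c
    2≤a+b+c = ≤-trans (+-mono-≤ 0<a 0<b) (m≤m+n (a + b) c)
    2≤M : 2 ≤ M
    2≤M = ≤-trans 2≤a+b+c (m≤m*n (a + b + c) L)
    L≤M : L ≤ M
    L≤M = m≤n*m L (a + b + c) {{>-nonZero (≤-trans (s≤s z≤n) 2≤a+b+c)}}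
    instance
      _ : NonZero M
      _ = >-nonZero (≤-trans (s≤s z≤n) 2≤M)
    shift : ∀ x y z → lin a b c (suc x) (suc y) (suc z) ≡ (a + b + c) + lin a b c x y z
    shift = go a b c
      where
      go : ∀ a b c x y z → a * suc x + b * suc y + c * suc z ≡ (a + b + c) + (a * x + b * y + c * z)
      go = solve-∀
    sets : ∀ N → 0 < N → ∃[ A ] (Unique A × All (λ x → 1 ≤ x × x ≤ N) A ×
      1 ^ F * N ^ E ≤ (M * C) ^ F * length A ^ F ×
      (∀ {x y z x′ y′ z′} → x ∈ A → y ∈ A → z ∈ A → x′ ∈ A → y′ ∈ A → z′ ∈ A →
        a * x + b * y + c * z ≡ a * x′ + b * y′ + c * z′ →
        Trivial a b c x y z x′ y′ z′))
    sets N 0<N with log-bracket 2≤M 0<N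
    ... | n , low , high with family n
    ...   | K , e , e< , dense , free =
      applyUpTo f K
      , Unique.applyUpTo⁺₁ f K (λ i<j j<K fi≡fj → <⇒≢ i<j (f-injective (<-trans i<j j<K) j<K fi≡fj))
      , All.applyUpTo⁺₁ f K (λ {i} _ → s≤s z≤n , ≤-trans (rebase-< L≤M n (e i)) low)
      , subst (λ k → 1 ^ F * N ^ E ≤ (M * C) ^ F * k ^ F) (sym (length-applyUpTo f K))
          (density-at {C = C} {K} E F n E≤F high (density {C = C} {K} E F α β n sparse dense))
      , avoids
      where
      f : ℕ → ℕ
      -- Moves the values from `[0, M ^ n)` into `[1, N]`; by `shift` the equation is invariant
      -- under this translation.
      f i = suc (rebase L M n (e i))
      -- Six variables equal to `i`, with only `x′` changed to `j`, form a solution, and either kind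
      -- of match yields `i ≡ j`.
      f-injective : ∀ {i j} → i < K → j < K → f i ≡ f j → i ≡ j
      f-injective {i} {j} i<K j<K fi≡fj
        with free {i} {i} {i} {j} {i} {i} i<K i<K i<K j<K i<K i<K
               (cong (λ r → lin a b c r (rebase L M n (e i)) (rebase L M n (e i))) (suc-injective fi≡fj))
      ... | inj₁ (i≡j , _)         = i≡j
      ... | inj₂ (_ , _ , i≡j , _) = i≡j
      avoids : ∀ {x y z x′ y′ z′} → x ∈ applyUpTo f K → y ∈ applyUpTo f K → z ∈ applyUpTo f K →
        x′ ∈ applyUpTo f K → y′ ∈ applyUpTo f K → z′ ∈ applyUpTo f K →
        a * x + b * y + c * z ≡ a * x′ + b * y′ + c * z′ → Trivial a b c x y z x′ y′ z′
      avoids x∈ y∈ z∈ x′∈ y′∈ z′∈ eq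
        with ∈-applyUpTo⁻ f x∈ | ∈-applyUpTo⁻ f y∈ | ∈-applyUpTo⁻ f z∈
           | ∈-applyUpTo⁻ f x′∈ | ∈-applyUpTo⁻ f y′∈ | ∈-applyUpTo⁻ f z′∈
      ... | x , x< , refl | y , y< , refl | z , z< , refl | x′ , x′< , refl | y′ , y′< , refl | z′ , z′< , refl =
        matched⇒trivial {a} {b} {c} {x} {y} {z} {x′} {y′} {z′} f (free x< y< z< x′< y′< z′<
          (+-cancelˡ-≡ (a + b + c) _ _ (trans (sym (shift (ρ x) (ρ y) (ρ z))) (trans eq (shift (ρ x′) (ρ y′) (ρ z′))))))
        where
        ρ = λ i → rebase L M n (e i)

-- Solutions in the digits

-- Equality of two variables is put as a linear relation, so that `rebase-Relation` can lift it from
-- digits to numbers.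
≡⇔Relation₁ : ∀ {x y z x′ y′ z′} → x ≡ x′ ⇔ Relation (+ 1) (+ 0) (+ 0) x y z x′ y′ z′
≡⇔Relation₁ {x} {y} {z} {x′} {y′} {z′} = mk⇔
  (λ eq → relation (trans (unit _ (δ y y′) (δ z z′)) (≡⇒δ≡0 eq)))
  (λ r → δ≡0⇒≡ (trans (sym (unit _ (δ y y′) (δ z z′))) (vanishes r)))
  where
  unit : ∀ i j k → + 1 ℤ.* i ℤ.+ + 0 ℤ.* j ℤ.+ + 0 ℤ.* k ≡ i
  unit = ℤ-Solver.solve-∀

≡⇔Relation₂ : ∀ {x y z x′ y′ z′} → y ≡ y′ ⇔ Relation (+ 0) (+ 1) (+ 0) x y z x′ y′ z′
≡⇔Relation₂ {x} {y} {z} {x′} {y′} {z′} = mk⇔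
  (λ eq → relation (trans (unit (δ x x′) _ (δ z z′)) (≡⇒δ≡0 eq)))
  (λ r → δ≡0⇒≡ (trans (sym (unit (δ x x′) _ (δ z z′))) (vanishes r)))
  where
  unit : ∀ i j k → + 0 ℤ.* i ℤ.+ + 1 ℤ.* j ℤ.+ + 0 ℤ.* k ≡ j
  unit = ℤ-Solver.solve-∀

≡⇔Relation₃ : ∀ {x y z x′ y′ z′} → z ≡ z′ ⇔ Relation (+ 0) (+ 0) (+ 1) x y z x′ y′ z′
≡⇔Relation₃ {x} {y} {z} {x′} {y′} {z′} = mk⇔
  (λ eq → relation (trans (unit (δ x x′) (δ y y′) _) (≡⇒δ≡0 eq)))
  (λ r → δ≡0⇒≡ (trans (sym (unit (δ x x′) (δ y y′) _)) (vanishes r)))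
  where
  unit : ∀ i j k → + 0 ℤ.* i ℤ.+ + 0 ℤ.* j ℤ.+ + 1 ℤ.* k ≡ k
  unit = ℤ-Solver.solve-∀

DigitRelation : (a b c L : ℕ) (α β γ : ℤ) → Set
DigitRelation a b c L α β γ = ∀ {x y z x′ y′ z′} →
  x < L → y < L → z < L → x′ < L → y′ < L → z′ < L →
  lin a b c x y z ≡ lin a b c x′ y′ z′ → Relation α β γ x y z x′ y′ z′

module _ {a b c : ℕ} (0<a : 0 < a) (0<b : 0 < b) {E F : ℕ} (E≤F : E ≤ F) where

  -- The three equalities lift from digits to numbers, so all `L ^ n` numbers can be kept.
  no-digit-solutions : ∀ {L} .{{_ : NonZero L}} →
    ((a + b + c) * L) ^ (E * 1) ≤ L ^ (F * 1) →
    (∀ {x y z x′ y′ z′} → x < L → y < L → z < L → x′ < L → y′ < L → z′ < L →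
      lin a b c x y z ≡ lin a b c x′ y′ z′ → x ≡ x′ × y ≡ y′ × z ≡ z′) →
    Conclusion E F a b c
  no-digit-solutions {L} sparse only = conclude {C = 1} E F 1 1 0<a 0<b (s≤s z≤n) E≤F sparse
    (λ n → L ^ n , (λ i → i) , (λ i< → i<) , ≤-reflexive (one (L ^ n)) , free n)
    where
    one : ∀ x → x ^ 1 ≡ (1 * x) ^ 1
    one x = cong (_^ 1) (sym (*-identityˡ x))
    digits₁ : DigitRelation a b c L (+ 1) (+ 0) (+ 0)
    digits₁ x< y< z< x′< y′< z′< eq = to ≡⇔Relation₁ (proj₁ (only x< y< z< x′< y′< z′< eq))
    digits₂ : DigitRelation a b c L (+ 0) (+ 1) (+ 0)
    digits₂ x< y< z< x′< y′< z′< eq = to ≡⇔Relation₂ (proj₁ (proj₂ (only x< y< z< x′< y′< z′< eq)))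
    digits₃ : DigitRelation a b c L (+ 0) (+ 0) (+ 1)
    digits₃ x< y< z< x′< y′< z′< eq = to ≡⇔Relation₃ (proj₂ (proj₂ (only x< y< z< x′< y′< z′< eq)))
    free : ∀ n → SolutionFree a b c (L ^ n) (λ i → rebase L ((a + b + c) * L) n i)
    free n x< y< z< x′< y′< z′< eq = inj₁
      ( from ≡⇔Relation₁ (rebase-Relation 0<a ≤-refl digits₁ n x< y< z< x′< y′< z′< eq)
      , from ≡⇔Relation₂ (rebase-Relation 0<a ≤-refl digits₂ n x< y< z< x′< y′< z′< eq)
      , from ≡⇔Relation₃ (rebase-Relation 0<a ≤-refl digits₃ n x< y< z< x′< y′< z′< eq))

  -- For digits, `b` divides `c (z − z′)`, hence `z − z′`, which is smaller than `L ≤ b` and so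
  -- vanishes. Cancelling `b` leaves `x + y = x′ + y′`. Both relations lift to the elements of the
  -- Sidon set.
  sidon-digits : ∀ {L} .{{_ : NonZero L}} → a ≡ b →
    ((a + b + c) * L) ^ (E * 16) ≤ L ^ (F * 7) → Coprime b c → L ≤ b → Conclusion E F a b c
  sidon-digits {L} a≡b sparse co L≤b = build sidon-family
    where
    b∣ : ∀ {i} → + b ℤ.∣ + c ℤ.* i → + b ℤ.∣ i
    b∣ = ℤ-coprime-divisor {+ b} {+ c} co
    instance
      _ : ℤ.NonZero (+ b)
      _ = ℤ.≢-nonZero {+ b} (λ h → <⇒≢ 0<b (sym (ℤ.+-injective h)))
    isolate : ∀ b c i j k → c ℤ.* k ≡ (b ℤ.* i ℤ.+ b ℤ.* j ℤ.+ c ℤ.* k) ℤ.+ b ℤ.* ℤ.- (i ℤ.+ j)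
    isolate = ℤ-Solver.solve-∀
    symmetric : DigitRelation a b c L (+ b) (+ b) (+ c)
    symmetric {x} {y} {z} {x′} {y′} {z′} _ _ _ _ _ _ eq =
      subst (λ m → Relation (+ m) (+ b) (+ c) x y z x′ y′ z′) a≡b (lin⇒Relation x y z x′ y′ z′ eq)
    δz≡0 : ∀ {x y z x′ y′ z′} → z < L → z′ < L → Relation (+ b) (+ b) (+ c) x y z x′ y′ z′ → δ z z′ ≡ + 0
    δz≡0 {x} {y} {z} {x′} {y′} {z′} z< z′< r = small-multiple {+ b}
      (b∣ (subst (+ b ℤ.∣_) (sym (trans (isolate (+ b) (+ c) (δ x x′) (δ y y′) (δ z z′))
            (trans (cong (ℤ._+ + b ℤ.* ℤ.- (δ x x′ ℤ.+ δ y y′)) (vanishes r)) (ℤ.+-identityˡ _))))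
          (m∣m*i (+ b) (ℤ.- (δ x x′ ℤ.+ δ y y′)))))
      (<-≤-trans (∣δ∣< z< z′<) L≤b)
    digits₃ : DigitRelation a b c L (+ 0) (+ 0) (+ 1)
    digits₃ x< y< z< x′< y′< z′< eq =
      to ≡⇔Relation₃ (δ≡0⇒≡ (δz≡0 z< z′< (symmetric x< y< z< x′< y′< z′< eq)))
    factor : ∀ b c i j k → b ℤ.* (+ 1 ℤ.* i ℤ.+ + 1 ℤ.* j ℤ.+ + 0 ℤ.* k) ≡ (b ℤ.* i ℤ.+ b ℤ.* j ℤ.+ c ℤ.* k) ℤ.+ ℤ.- c ℤ.* k
    factor = ℤ-Solver.solve-∀
    digits₁₂ : DigitRelation a b c L (+ 1) (+ 1) (+ 0)
    digits₁₂ {x} {y} {z} {x′} {y′} {z′} x< y< z< x′< y′< z′< eq = relation (ℤ.*-cancelˡ-≡ (+ b) _ (+ 0)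
      (trans (factor (+ b) (+ c) (δ x x′) (δ y y′) (δ z z′))
        (trans (cong₂ (λ i j → i ℤ.+ ℤ.- (+ c) ℤ.* j) (vanishes r) (δz≡0 z< z′< r))
          (vanish (+ b) (+ c)))))
      where
      r = symmetric x< y< z< x′< y′< z′< eq
      vanish : ∀ b c → + 0 ℤ.+ ℤ.- c ℤ.* + 0 ≡ b ℤ.* + 0
      vanish = ℤ-Solver.solve-∀
    sums : ∀ {x y z x′ y′ z′} → Relation (+ 1) (+ 1) (+ 0) x y z x′ y′ z′ → x + y ≡ x′ + y′
    sums {x} {y} {z} {x′} {y′} {z′} h = δ≡0⇒≡ (trans (cong₂ ℤ._-_ (ℤ.pos-+ x y) (ℤ.pos-+ x′ y′))
      (trans (regroup (+ x) (+ y) (+ x′) (+ y′) (δ z z′)) (vanishes h)))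
      where
      regroup : ∀ x y x′ y′ k → (x ℤ.+ y) ℤ.- (x′ ℤ.+ y′) ≡ + 1 ℤ.* (x ℤ.- x′) ℤ.+ + 1 ℤ.* (y ℤ.- y′) ℤ.+ + 0 ℤ.* k
      regroup = ℤ-Solver.solve-∀
    free : ∀ n {K e} → (∀ {i} → i < K → e i < L ^ n) → Sidon K e →
           SolutionFree a b c K (λ i → rebase L ((a + b + c) * L) n (e i))
    free n {K} {e} e< sidon {x} {y} {z} {x′} {y′} {z′} x< y< z< x′< y′< z′< eq =
      [ (λ { (x≡x′ , y≡y′) → inj₁ (x≡x′ , y≡y′ , z≡z′) })
      , (λ { (x≡y′ , y≡x′) → inj₂ (a≡b , x≡y′ , y≡x′ , z≡z′) }) ]′
      (sidon x< y< x′< y′< (sums (rebase-Relation 0<a ≤-refl digits₁₂ n (e< x<) (e< y<) (e< z<) (e< x′<) (e< y′<) (e< z′<) eq)))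
      where
      ez≡ez′ : e z ≡ e z′
      ez≡ez′ = from ≡⇔Relation₃
        (rebase-Relation 0<a ≤-refl digits₃ n (e< x<) (e< y<) (e< z<) (e< x′<) (e< y′<) (e< z′<) eq)
      -- The Sidon property for `z, z, z′, z′` serves as injectivity of `e`.
      z≡z′ : z ≡ z′
      z≡z′ = [ proj₁ , proj₁ ]′ (sidon z< z< z′< z′< (cong₂ _+_ ez≡ez′ ez≡ez′))
    build : (∃[ C ] ∀ X → 1 ≤ X → ∃[ K ] ∃[ e ]
      ((∀ {i} → i < K → e i < X) × X ^ 7 ≤ (C * K) ^ 16 × Sidon K e)) → Conclusion E F a b c
    -- `suc C` in place of `C`: the constant becomes a factor of a denominator and has to be
    -- positive.
    build (C , family) = conclude {C = suc C} E F 7 16 0<a 0<b (s≤s z≤n) E≤F sparse (λ n →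
      let K , e , e< , dense , sidon = family (L ^ n) (m^n>0 L n)
      in K , e , e< , ≤-trans dense (^-monoˡ-≤ 16 (*-monoˡ-≤ K (n≤1+n C))) , free n e< sidon)

-- Eliminating `a` from the two equations leaves `b (u j − v i) = c (w i − u k)`, and `b` is coprime
-- to `c`.
cross-∣ : ∀ {a b c : ℕ} → Coprime b c → ∀ {u v w i j k} →
  + a ℤ.* u ℤ.+ + b ℤ.* v ℤ.+ + c ℤ.* w ≡ + 0 → + a ℤ.* i ℤ.+ + b ℤ.* j ℤ.+ + c ℤ.* k ≡ + 0 →
  + c ℤ.∣ u ℤ.* j ℤ.- v ℤ.* i
cross-∣ {a} {b} {c} co {u} {v} {w} {i} {j} {k} h₁ h₂ = ℤ-coprime-divisor {+ c} {+ b} (Coprimality.sym co)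
  (subst (+ c ℤ.∣_) (sym (trans (identity (+ a) (+ b) (+ c) u v w i j k)
     (trans (cong₂ (λ s t → + c ℤ.* (w ℤ.* i ℤ.- u ℤ.* k) ℤ.+ u ℤ.* s ℤ.- i ℤ.* t) h₂ h₁)
       (vanish (+ c ℤ.* (w ℤ.* i ℤ.- u ℤ.* k)) u i))))
   (m∣m*i (+ c) (w ℤ.* i ℤ.- u ℤ.* k)))
  where
  identity : ∀ a b c u v w i j k → b ℤ.* (u ℤ.* j ℤ.- v ℤ.* i) ≡
    c ℤ.* (w ℤ.* i ℤ.- u ℤ.* k) ℤ.+ u ℤ.* (a ℤ.* i ℤ.+ b ℤ.* j ℤ.+ c ℤ.* k) ℤ.- i ℤ.* (a ℤ.* u ℤ.+ b ℤ.* v ℤ.+ c ℤ.* w)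
  identity = ℤ-Solver.solve-∀
  vanish : ∀ t u i → t ℤ.+ u ℤ.* + 0 ℤ.- i ℤ.* + 0 ≡ t
  vanish = ℤ-Solver.solve-∀

-- A short solution and a digit solution are parallel, because their cross
-- product is divisible by c but smaller than c.
parallel : ∀ {a b c R L : ℕ} → Coprime b c → R * L + R * L ≤ c → ∀ {u v w i j k} →
  ∣ u ∣ < R → ∣ v ∣ < R → ∣ i ∣ < L → ∣ j ∣ < L →
  + a ℤ.* u ℤ.+ + b ℤ.* v ℤ.+ + c ℤ.* w ≡ + 0 → + a ℤ.* i ℤ.+ + b ℤ.* j ℤ.+ + c ℤ.* k ≡ + 0 →
  u ℤ.* j ℤ.- v ℤ.* i ≡ + 0
parallel {a} {b} {c} {R} {L} co wide {u} {v} {w} {i} {j} {k} u< v< i< j< h₁ h₂ =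
  small-multiple {+ c} (cross-∣ {a} {b} {c} co {u} {v} {w} {i} {j} {k} h₁ h₂) (begin-strict
    ∣ u ℤ.* j ℤ.- v ℤ.* i ∣           ≤⟨ ℤ.∣i-j∣≤∣i∣+∣j∣ (u ℤ.* j) (v ℤ.* i) ⟩
    ∣ u ℤ.* j ∣ + ∣ v ℤ.* i ∣         ≡⟨ cong₂ _+_ (ℤ.abs-* u j) (ℤ.abs-* v i) ⟩
    ∣ u ∣ * ∣ j ∣ + ∣ v ∣ * ∣ i ∣     <⟨ +-mono-< (*-mono-< u< j<) (*-mono-< v< i<) ⟩
    R * L + R * L                     ≤⟨ wide ⟩
    c                                 ∎)
  where open ≤-Reasoning

cross⇒relation : ∀ {u s dX dY : ℤ} → u ℤ.* dY ℤ.- s ℤ.* dX ≡ + 0 → s ℤ.* dX ≡ u ℤ.* dY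
cross⇒relation {u} {s} {dX} {dY} h = sym (ℤ.i-j≡0⇒i≡j (u ℤ.* dY) (s ℤ.* dX) h)

independent-injective : ∀ {v u K e} → Independent v u K e → ∀ {i j} → i < K → j < K → e i ≡ e j → i ≡ j
independent-injective {v} {u} {e = e} ind {i} i<K j<K eq = proj₁ (ind i<K j<K i<K i<K
  (trans (cong (v ℤ.*_) (≡⇒δ≡0 eq))
    (trans (trans (ℤ.*-zeroʳ v) (sym (ℤ.*-zeroʳ u))) (cong (u ℤ.*_) (sym (≡⇒δ≡0 {e i} refl))))))

-- Independence of one pair suffices: it settles `x` and `y`, and then `u (e z − e z′) = 0` settles
-- `z`.
independent-matches : ∀ {s t u K e} → u ≢ + 0 → Independent s u K e →
  ∀ {x y z x′ y′ z′} → x < K → y < K → z < K → x′ < K → y′ < K → z′ < K →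
  s ℤ.* δ (e x) (e x′) ≡ u ℤ.* δ (e y) (e y′) → t ℤ.* δ (e x) (e x′) ≡ u ℤ.* δ (e z) (e z′) →
  x ≡ x′ × y ≡ y′ × z ≡ z′
independent-matches {s} {t} {u} {K} {e} u≢0 ind {x} {y} {z} {x′} {y′} {z′} x< y< z< x′< y′< z′< h₁ h₂ =
  proj₁ pair , proj₂ pair , independent-injective {s} {u} ind z< z′< ez≡ez′
  where
  pair : x ≡ x′ × y ≡ y′
  pair = ind x< x′< y< y′< h₁
  product≡0 : u ℤ.* δ (e z) (e z′) ≡ + 0
  product≡0 = trans (sym h₂) (trans (cong (t ℤ.*_) (≡⇒δ≡0 (cong e (proj₁ pair)))) (ℤ.*-zeroʳ t))
  ez≡ez′ : e z ≡ e z′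
  ez≡ez′ = [ (λ u≡0 → contradiction u≡0 u≢0) , δ≡0⇒≡ ]′ (ℤ.i*j≡0⇒i≡0∨j≡0 u product≡0)

module _ {a b c : ℕ} (0<a : 0 < a) (0<b : 0 < b) (b≤c : b ≤ c) (co : Coprime b c)
         {E F : ℕ} (E≤F : E ≤ F) {R L : ℕ} .{{_ : NonZero L}} (wide : R * L + R * L ≤ b)
         (sparse : ((a + b + c) * L) ^ (E * 2) ≤ L ^ (F * 1))
         {u v w : ℤ} (u< : ∣ u ∣ < R) (v< : ∣ v ∣ < R) (w< : ∣ w ∣ < R)
         (solution : + a ℤ.* u ℤ.+ + b ℤ.* v ℤ.+ + c ℤ.* w ≡ + 0)
         (u≢0 : u ≢ + 0) where

  private
    exchange : ∀ a b c i j k → a ℤ.* i ℤ.+ b ℤ.* j ℤ.+ c ℤ.* k ≡ a ℤ.* i ℤ.+ c ℤ.* k ℤ.+ b ℤ.* j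
    exchange = ℤ-Solver.solve-∀

    negated : ∀ u s i j k → s ℤ.* i ℤ.+ ℤ.- u ℤ.* j ℤ.+ + 0 ℤ.* k ≡ ℤ.- (u ℤ.* j ℤ.- s ℤ.* i)
    negated = ℤ-Solver.solve-∀

    negated′ : ∀ u s i j k → s ℤ.* i ℤ.+ + 0 ℤ.* k ℤ.+ ℤ.- u ℤ.* j ≡ ℤ.- (u ℤ.* j ℤ.- s ℤ.* i)
    negated′ = ℤ-Solver.solve-∀

    digits-v : DigitRelation a b c L v (ℤ.- u) (+ 0)
    digits-v {x} {y} {z} {x′} {y′} {z′} x< y< z< x′< y′< z′< eq = relation (trans
      (negated u v (δ x x′) (δ y y′) (δ z z′))
      (cong ℤ.-_ (parallel {a} {b} {c} {R} {L} co (≤-trans wide b≤c) {u} {v} {w} {δ x x′} {δ y y′} {δ z z′}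
        u< v< (∣δ∣< x< x′<) (∣δ∣< y< y′<) solution (vanishes (lin⇒Relation {a} {b} {c} x y z x′ y′ z′ eq)))))

    -- `parallel` with `b` and `c` exchanged. The modulus is now `b`, which is why `wide` bounds by
    -- `b` and not by `c`.
    digits-w : DigitRelation a b c L w (+ 0) (ℤ.- u)
    digits-w {x} {y} {z} {x′} {y′} {z′} x< y< z< x′< y′< z′< eq = relation (trans
      (negated′ u w (δ x x′) (δ z z′) (δ y y′))
      (cong ℤ.-_ (parallel {a} {c} {b} {R} {L} (Coprimality.sym co) wide {u} {w} {v} {δ x x′} {δ z z′} {δ y y′}
        u< w< (∣δ∣< x< x′<) (∣δ∣< z< z′<)
        (trans (sym (exchange (+ a) (+ b) (+ c) u v w)) solution)
        (trans (sym (exchange (+ a) (+ b) (+ c) (δ x x′) (δ y y′) (δ z z′)))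
          (vanishes (lin⇒Relation {a} {b} {c} x y z x′ y′ z′ eq))))))

    proportional-v : ∀ {x y z x′ y′ z′} → Relation v (ℤ.- u) (+ 0) x y z x′ y′ z′ → v ℤ.* δ x x′ ≡ u ℤ.* δ y y′
    proportional-v {x} {y} {z} {x′} {y′} {z′} r = cross⇒relation {u} {v}
      (ℤ.neg-injective (trans (sym (negated u v (δ x x′) (δ y y′) (δ z z′))) (vanishes r)))

    proportional-w : ∀ {x y z x′ y′ z′} → Relation w (+ 0) (ℤ.- u) x y z x′ y′ z′ → w ℤ.* δ x x′ ≡ u ℤ.* δ z z′
    proportional-w {x} {y} {z} {x′} {y′} {z′} r = cross⇒relation {u} {w}
      (ℤ.neg-injective (trans (sym (negated′ u w (δ x x′) (δ z z′) (δ y y′))) (vanishes r)))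

    conclude-from : ∀ {s} → IndependentFamily s u →
      (∀ n {K e} → (∀ {i} → i < K → e i < L ^ n) → Independent s u K e →
        SolutionFree a b c K (λ i → rebase L ((a + b + c) * L) n (e i))) →
      Conclusion E F a b c
    conclude-from (C , family) free = conclude {C = suc C} E F 1 2 0<a 0<b (s≤s z≤n) E≤F sparse (λ n →
      let K , e , e< , dense , ind = family (L ^ n) (m^n>0 L n)
      in K , e , e< , ≤-trans (≤-reflexive (^-identityʳ (L ^ n))) (≤-trans dense (^-monoˡ-≤ 2 (*-monoˡ-≤ K (n≤1+n C)))) , free n e< ind)

  -- The pair consists of `u` and whichever of `v`, `w` qualifies; proportionality settles the
  -- remaining coordinate.
  parallel-digits : (v ≢ + 0 × ∣ v ∣ ≢ ∣ u ∣) ⊎ (w ≢ + 0 × ∣ w ∣ ≢ ∣ u ∣) → Conclusion E F a b c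
  parallel-digits (inj₁ (v≢0 , v≢u)) = conclude-from {v} (independent-family {v} {u} v≢0 u≢0 v≢u)
    (λ n {K} {e} e< ind {x} {y} {z} {x′} {y′} {z′} x< y< z< x′< y′< z′< eq →
      inj₁ (independent-matches {v} {w} {u} {K} {e} u≢0 ind x< y< z< x′< y′< z′<
        (proportional-v (rebase-Relation 0<a ≤-refl digits-v n (e< x<) (e< y<) (e< z<) (e< x′<) (e< y′<) (e< z′<) eq))
        (proportional-w (rebase-Relation 0<a ≤-refl digits-w n (e< x<) (e< y<) (e< z<) (e< x′<) (e< y′<) (e< z′<) eq))))
  parallel-digits (inj₂ (w≢0 , w≢u)) = conclude-from {w} (independent-family {w} {u} w≢0 u≢0 w≢u)
    (λ n {K} {e} e< ind {x} {y} {z} {x′} {y′} {z′} x< y< z< x′< y′< z′< eq →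
      let x≡x′ , z≡z′ , y≡y′ = independent-matches {w} {v} {u} {K} {e} u≢0 ind x< z< y< x′< z′< y′<
            (proportional-w (rebase-Relation 0<a ≤-refl digits-w n (e< x<) (e< y<) (e< z<) (e< x′<) (e< y′<) (e< z′<) eq))
            (proportional-v (rebase-Relation 0<a ≤-refl digits-v n (e< x<) (e< y<) (e< z<) (e< x′<) (e< y′<) (e< z′<) eq))
      in inj₁ (x≡x′ , y≡y′ , z≡z′))

-- Two differences of distinct absolute value

infixl 7 _⁺_ _⁻_

data Unit± : Set where
  none± plus± minus± : Unit±

-- Positive and negative part of `ε n` for `ε` equal to 0, 1 or -1, so that the relation between
-- coefficients can be refuted in natural numbers.
_⁺_ _⁻_ : Unit± → ℕ → ℕ
plus± ⁺ n = n
_    ⁺ n = 0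
minus± ⁻ n = n
_     ⁻ n = 0

-- That is, `v = ε u`, multiplied by `n` because it is applied to a term of the equation with
-- coefficient `n`.
Multiple± : ℤ → ℤ → Set
Multiple± v u = Σ Unit± λ ε → ∀ n → + n ℤ.* v ≡ δ (ε ⁺ n) (ε ⁻ n) ℤ.* u

∣∣≡⇒≡± : ∀ i j → ∣ i ∣ ≡ ∣ j ∣ → i ≡ j ⊎ i ≡ ℤ.- j
∣∣≡⇒≡± (+ m)        (+ n)        refl = inj₁ refl
∣∣≡⇒≡± (+ m)        ℤ.-[1+ n ]   refl = inj₂ refl
∣∣≡⇒≡± ℤ.-[1+ m ]   (+ n)        refl = inj₂ refl
∣∣≡⇒≡± ℤ.-[1+ m ]   ℤ.-[1+ n ]   refl = inj₁ refl

∣∣≡⇒Multiple± : ∀ v u → ∣ v ∣ ≡ ∣ u ∣ → Multiple± v u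
∣∣≡⇒Multiple± v u eq = [ (λ { refl → plus± , positive u }) , (λ { refl → minus± , negative u }) ]′ (∣∣≡⇒≡± v u eq)
  where
  positive : ∀ u n → + n ℤ.* u ≡ (+ n ℤ.- + 0) ℤ.* u
  positive u n = identity (+ n) u
    where
    identity : ∀ n u → n ℤ.* u ≡ (n ℤ.- + 0) ℤ.* u
    identity = ℤ-Solver.solve-∀
  negative : ∀ u n → + n ℤ.* ℤ.- u ≡ (+ 0 ℤ.- + n) ℤ.* u
  negative u n = identity (+ n) u
    where
    identity : ∀ n u → n ℤ.* ℤ.- u ≡ (+ 0 ℤ.- n) ℤ.* u
    identity = ℤ-Solver.solve-∀

usable? : ∀ v u → (v ≢ + 0 × ∣ v ∣ ≢ ∣ u ∣) ⊎ Multiple± v u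
usable? v u with v ℤ.≟ + 0
... | yes refl = inj₂ (none± , λ n → trans (ℤ.*-zeroʳ (+ n)) (sym (ℤ.*-zeroˡ u)))
... | no v≢0 with ∣ v ∣ ≟ ∣ u ∣
...   | yes eq = inj₂ (∣∣≡⇒Multiple± v u eq)
...   | no neq = inj₁ (v≢0 , neq)

-- Of the nine sign patterns in `a + ε b + η c = 0`, the order of the coefficients excludes all but
-- `a + b = c`, which is excluded by hypothesis.
multiples-impossible : ∀ {a b c} → 0 < a → a < b → b < c → c ≢ a + b → ∀ ε η →
  a + ε ⁺ b + η ⁺ c ≢ ε ⁻ b + η ⁻ c
multiples-impossible {a} {b} {c} 0<a a<b b<c c≢a+b = go
  where
  go : ∀ ε η → a + ε ⁺ b + η ⁺ c ≢ ε ⁻ b + η ⁻ c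
  go none±  none±  = >⇒≢ (≤-trans 0<a (≤-trans (m≤m+n a 0) (m≤m+n (a + 0) 0)))
  go none±  plus±  = >⇒≢ (≤-trans 0<a (≤-trans (m≤m+n a 0) (m≤m+n (a + 0) c)))
  go none±  minus± h = <⇒≢ (<-trans a<b b<c) (trans (sym (trans (+-identityʳ (a + 0)) (+-identityʳ a))) h)
  go plus±  none±  = >⇒≢ (≤-trans 0<a (≤-trans (m≤m+n a b) (m≤m+n (a + b) 0)))
  go plus±  plus±  = >⇒≢ (≤-trans 0<a (≤-trans (m≤m+n a b) (m≤m+n (a + b) c)))
  go plus±  minus± h = c≢a+b (sym (trans (sym (+-identityʳ (a + b))) h))
  go minus± none±  h = <⇒≢ a<b (trans (sym (trans (+-identityʳ (a + 0)) (+-identityʳ a))) (trans h (+-identityʳ b)))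
  go minus± plus±  h = <⇒≢ (<-≤-trans b<c (m≤n+m c (a + 0))) (sym (trans h (+-identityʳ b)))
  go minus± minus± h = <⇒≢ (<-≤-trans a<b (m≤m+n b c)) (trans (sym (trans (+-identityʳ (a + 0)) (+-identityʳ a))) h)

-- If neither `v` nor `w` qualifies, then `v = ε u` and `w = η u`, and cancelling `u` leaves
-- `a + ε b + η c = 0`.
select : ∀ {a b c} → 0 < a → a < b → b < c → c ≢ a + b → ∀ {u v w} →
  + a ℤ.* u ℤ.+ + b ℤ.* v ℤ.+ + c ℤ.* w ≡ + 0 → u ≢ + 0 →
  (v ≢ + 0 × ∣ v ∣ ≢ ∣ u ∣) ⊎ (w ≢ + 0 × ∣ w ∣ ≢ ∣ u ∣)
select {a} {b} {c} 0<a a<b b<c c≢a+b {u} {v} {w} solution u≢0 with usable? v u | usable? w u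
... | inj₁ good      | _              = inj₁ good
... | inj₂ _         | inj₁ good      = inj₂ good
... | inj₂ (ε , b*v) | inj₂ (η , c*w) =
  contradiction (δ≡0⇒≡ ([ (λ h → h) , (λ u≡0 → contradiction u≡0 u≢0) ]′ (ℤ.i*j≡0⇒i≡0∨j≡0 _ product≡0)))
    (multiples-impossible 0<a a<b b<c c≢a+b ε η)
  where
  regroup : ∀ a p p′ q q′ u → ((a ℤ.+ p ℤ.+ q) ℤ.- (p′ ℤ.+ q′)) ℤ.* u ≡ a ℤ.* u ℤ.+ (p ℤ.- p′) ℤ.* u ℤ.+ (q ℤ.- q′) ℤ.* u
  regroup = ℤ-Solver.solve-∀
  product≡0 : δ (a + ε ⁺ b + η ⁺ c) (ε ⁻ b + η ⁻ c) ℤ.* u ≡ + 0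
  product≡0 = trans (regroup (+ a) (+ (ε ⁺ b)) (+ (ε ⁻ b)) (+ (η ⁺ c)) (+ (η ⁻ c)) u)
    (trans (cong₂ (λ i j → + a ℤ.* u ℤ.+ i ℤ.+ j) (sym (b*v b)) (sym (c*w c))) solution)

-- If `u = 0`, then `b v = −c w`, so `c` divides `v`; being smaller than `c`, `v` vanishes, and then
-- so does `w`.
first≢0 : ∀ {a b c R} → 0 < c → R ≤ c → Coprime b c → ∀ {u v w} → ∣ v ∣ < R →
  + a ℤ.* u ℤ.+ + b ℤ.* v ℤ.+ + c ℤ.* w ≡ + 0 → (u ≡ + 0 → v ≡ + 0 → w ≡ + 0 → ⊥) → u ≢ + 0
first≢0 {a} {b} {c} 0<c R≤c co {u} {v} {w} v< solution nonzero refl = nonzero refl v≡0 w≡0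
  where
  isolate : ∀ a b c v w → b ℤ.* v ≡ (a ℤ.* + 0 ℤ.+ b ℤ.* v ℤ.+ c ℤ.* w) ℤ.+ c ℤ.* ℤ.- w
  isolate = ℤ-Solver.solve-∀
  v≡0 : v ≡ + 0
  v≡0 = small-multiple {+ c} (ℤ-coprime-divisor {+ c} {+ b} (Coprimality.sym co)
    (subst (+ c ℤ.∣_) (sym (trans (isolate (+ a) (+ b) (+ c) v w)
      (trans (cong (ℤ._+ + c ℤ.* ℤ.- w) solution) (ℤ.+-identityˡ _)))) (m∣m*i (+ c) (ℤ.- w)))) (<-≤-trans v< R≤c)
  only : ∀ a b c w → c ℤ.* w ≡ a ℤ.* + 0 ℤ.+ b ℤ.* + 0 ℤ.+ c ℤ.* w
  only = ℤ-Solver.solve-∀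
  w≡0 : w ≡ + 0
  w≡0 = [ (λ c≡0 → contradiction (sym (ℤ.+-injective c≡0)) (<⇒≢ 0<c)) , (λ h → h) ]′
    (ℤ.i*j≡0⇒i≡0∨j≡0 (+ c) (trans (only (+ a) (+ b) (+ c) w)
      (trans (cong (λ i → + a ℤ.* + 0 ℤ.+ + b ℤ.* i ℤ.+ + c ℤ.* w) (sym v≡0)) solution)))

-- Nontrivial in the sense that some difference is nonzero, which is weaker than failing `Trivial`.
-- Bounding every variable makes it decidable.
NontrivialSolution : (a b c R : ℕ) → Set
NontrivialSolution a b c R =
  ∃ λ x → x < R × ∃ λ y → y < R × ∃ λ z → z < R ×
  ∃ λ x′ → x′ < R × ∃ λ y′ → y′ < R × ∃ λ z′ → z′ < R ×
  (lin a b c x y z ≡ lin a b c x′ y′ z′ × ¬ (x ≡ x′ × y ≡ y′ × z ≡ z′))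

nontrivialSolution? : ∀ a b c R → Dec (NontrivialSolution a b c R)
nontrivialSolution? a b c R =
  anyUpTo? (λ x → anyUpTo? (λ y → anyUpTo? (λ z →
  anyUpTo? (λ x′ → anyUpTo? (λ y′ → anyUpTo? (λ z′ →
    (lin a b c x y z ≟ lin a b c x′ y′ z′) ×-dec ¬? ((x ≟ x′) ×-dec ((y ≟ y′) ×-dec (z ≟ z′))))
  R) R) R) R) R) R

distinct-coefficients : ∀ {a b c E F} R L .{{_ : NonZero R}} .{{_ : NonZero L}} →
  0 < a → a < b → b < c → c ≢ a + b → Coprime b c → E ≤ F → R * L + R * L ≤ b →
  ((a + b + c) * R) ^ (E * 1) ≤ R ^ (F * 1) → ((a + b + c) * L) ^ (E * 2) ≤ L ^ (F * 1) →
  Conclusion E F a b c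
distinct-coefficients {a} {b} {c} R L 0<a a<b b<c c≢a+b co E≤F wide sparse-R sparse-L
  with nontrivialSolution? a b c R
... | no none = no-digit-solutions 0<a (<-trans 0<a a<b) E≤F sparse-R
  (λ {x} {y} {z} {x′} {y′} {z′} x< y< z< x′< y′< z′< eq →
    decidable-stable ((x ≟ x′) ×-dec ((y ≟ y′) ×-dec (z ≟ z′)))
      (λ nontrivial → none (x , x< , y , y< , z , z< , x′ , x′< , y′ , y′< , z′ , z′< , eq , nontrivial)))
... | yes (x , x< , y , y< , z , z< , x′ , x′< , y′ , y′< , z′ , z′< , eq , nontrivial) =
  parallel-digits 0<a 0<b (<⇒≤ b<c) co E≤F wide sparse-L
    {δ x x′} {δ y y′} {δ z z′} (∣δ∣< x< x′<) (∣δ∣< y< y′<) (∣δ∣< z< z′<) solution u≢0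
    (select 0<a a<b b<c c≢a+b {δ x x′} {δ y y′} {δ z z′} solution u≢0)
  where
  0<b : 0 < b
  0<b = <-trans 0<a a<b
  solution : + a ℤ.* δ x x′ ℤ.+ + b ℤ.* δ y y′ ℤ.+ + c ℤ.* δ z z′ ≡ + 0
  solution = vanishes (lin⇒Relation {a} {b} {c} x y z x′ y′ z′ eq)
  R≤c : R ≤ c
  R≤c = ≤-trans (m≤m*n R L) (≤-trans (m≤m+n (R * L) (R * L)) (≤-trans wide (<⇒≤ b<c)))
  u≢0 : δ x x′ ≢ + 0
  u≢0 = first≢0 {a} {b} {c} (<-trans 0<b b<c) R≤c co {δ x x′} {δ y y′} {δ z z′} (∣δ∣< y< y′<) solution
    (λ u≡0 v≡0 w≡0 → nontrivial (δ≡0⇒≡ u≡0 , δ≡0⇒≡ v≡0 , δ≡0⇒≡ w≡0))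

-- Choice of the parameters

root : ∀ {b} k h .{{_ : NonZero h}} → 2 * (2 ^ k) ^ h ≤ b →
  ∃[ t ] (2 ^ k ≤ t × 2 * t ^ h ≤ b × b ≤ 2 ^ suc h * t ^ h)
root {b} k h large with bracket (λ t → 2 * t ^ h) b (suc b) (≤-trans (≤-reflexive (cong (2 *_) (0^h h))) z≤n) above
  where
  0^h : ∀ h .{{_ : NonZero h}} → 0 ^ h ≡ 0
  0^h (suc h) = refl
  above : b < 2 * suc b ^ h
  above = ≤-trans (≤-reflexive (sym (^-identityʳ (suc b)))) (≤-trans (^-monoʳ-≤ (suc b) (>-nonZero⁻¹ h)) (m≤n*m (suc b ^ h) 2))
... | t , low , high = t , 2^k≤t , low , upper
  where
  open ≤-Reasoning
  2^k≤t : 2 ^ k ≤ t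
  2^k≤t with 2 ^ k ≤? t
  ... | yes h′ = h′
  ... | no  h′ = contradiction (≤-trans (*-monoʳ-≤ 2 (^-monoˡ-≤ h (≰⇒> h′))) large) (<⇒≱ high)
  1≤t : 1 ≤ t
  1≤t = ≤-trans (m^n>0 2 k) 2^k≤t
  -- From `b < 2 (t + 1) ^ h` and `t + 1 ≤ 2 t`.
  upper : b ≤ 2 ^ suc h * t ^ h
  upper = begin
    b                       ≤⟨ <⇒≤ high ⟩
    2 * suc t ^ h           ≤⟨ *-monoʳ-≤ 2 (^-monoˡ-≤ h (+-monoˡ-≤ t 1≤t)) ⟩
    2 * (t + t) ^ h         ≡⟨ cong (λ s → 2 * (t + s) ^ h) (+-identityʳ t) ⟨
    2 * (2 * t) ^ h         ≡⟨ cong (2 *_) (^-distribʳ-* h 2 t) ⟩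
    2 * (2 ^ h * t ^ h)     ≡⟨ *-assoc 2 (2 ^ h) (t ^ h) ⟨
    2 ^ suc h * t ^ h       ∎

module Sizes {b c t S : ℕ} (E G g h k j : ℕ) (c^E≤b^G : c ^ E ≤ b ^ G) (b≤ : b ≤ 2 ^ g * t ^ h)
             (2^k≤t : 2 ^ k ≤ t) (S≤4c : S ≤ 2 ^ 2 * c) (exponents : 2 * E + g * G ≤ k * j) where
  open ≤-Reasoning

  -- The powers of 2 from `S ≤ 4 c` and from rounding the root are absorbed by `t ^ j`, as
  -- `2 ^ k ≤ t`.
  S^E≤ : S ^ E ≤ t ^ (j + h * G)
  S^E≤ = begin
    S ^ E                                     ≤⟨ ^-monoˡ-≤ E S≤4c ⟩
    (2 ^ 2 * c) ^ E                           ≡⟨ ^-distribʳ-* E (2 ^ 2) c ⟩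
    (2 ^ 2) ^ E * c ^ E                       ≤⟨ *-mono-≤ (≤-reflexive (^-*-assoc 2 2 E)) c^E≤b^G ⟩
    2 ^ (2 * E) * b ^ G                       ≤⟨ *-monoʳ-≤ (2 ^ (2 * E)) (^-monoˡ-≤ G b≤) ⟩
    2 ^ (2 * E) * (2 ^ g * t ^ h) ^ G         ≡⟨ cong (2 ^ (2 * E) *_) (^-distribʳ-* G (2 ^ g) (t ^ h)) ⟩
    2 ^ (2 * E) * ((2 ^ g) ^ G * (t ^ h) ^ G) ≡⟨ *-assoc (2 ^ (2 * E)) _ _ ⟨
    2 ^ (2 * E) * (2 ^ g) ^ G * (t ^ h) ^ G   ≡⟨ cong (λ x → 2 ^ (2 * E) * x * (t ^ h) ^ G) (^-*-assoc 2 g G) ⟩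
    2 ^ (2 * E) * 2 ^ (g * G) * (t ^ h) ^ G   ≡⟨ cong₂ _*_ (sym (^-distribˡ-+-* 2 (2 * E) (g * G))) (^-*-assoc t h G) ⟩
    2 ^ (2 * E + g * G) * t ^ (h * G)         ≤⟨ *-monoˡ-≤ (t ^ (h * G)) (^-monoʳ-≤ 2 exponents) ⟩
    2 ^ (k * j) * t ^ (h * G)                 ≡⟨ cong (_* t ^ (h * G)) (^-*-assoc 2 k j) ⟨
    (2 ^ k) ^ j * t ^ (h * G)                 ≤⟨ *-monoˡ-≤ (t ^ (h * G)) (^-monoˡ-≤ j 2^k≤t) ⟩
    t ^ j * t ^ (h * G)                       ≡⟨ ^-distribˡ-+-* t j (h * G) ⟨
    t ^ (j + h * G)                           ∎

  -- With `S ^ E` bounded by a power of `t`, only exponents of `t` remain to be compared.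
  sparse : ∀ i F α β → (j + h * G + i * E) * β ≤ i * (F * α) → (S * t ^ i) ^ (E * β) ≤ (t ^ i) ^ (F * α)
  sparse i F α β exponents′ = begin
    (S * t ^ i) ^ (E * β)                 ≡⟨ ^-*-assoc (S * t ^ i) E β ⟨
    ((S * t ^ i) ^ E) ^ β                 ≡⟨ cong (_^ β) (^-distribʳ-* E S (t ^ i)) ⟩
    (S ^ E * (t ^ i) ^ E) ^ β             ≤⟨ ^-monoˡ-≤ β (*-mono-≤ S^E≤ (≤-reflexive (^-*-assoc t i E))) ⟩
    (t ^ (j + h * G) * t ^ (i * E)) ^ β   ≡⟨ cong (_^ β) (^-distribˡ-+-* t (j + h * G) (i * E)) ⟨
    (t ^ (j + h * G + i * E)) ^ β         ≡⟨ ^-*-assoc t (j + h * G + i * E) β ⟩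
    t ^ ((j + h * G + i * E) * β)         ≤⟨ ^-monoʳ-≤ t {{>-nonZero (≤-trans (m^n>0 2 k) 2^k≤t)}} exponents′ ⟩
    t ^ (i * (F * α))                     ≡⟨ ^-*-assoc t i (F * α) ⟨
    (t ^ i) ^ (F * α)                     ∎

-- The bases are `R = t ^ i₁` and `L = t ^ i₂` for `a < b`, and `L = t ^ h` for `a = b`. The last
-- three exponent inequalities are their density conditions, in this order.
large-coefficients : ∀ {a b c} E F G h k j i₁ i₂ .{{_ : NonZero h}} → E ≤ F → i₁ + i₂ ≡ h →
  2 * E + suc h * G ≤ k * j →
  (j + h * G + i₁ * E) * 1 ≤ i₁ * (F * 1) → (j + h * G + i₂ * E) * 2 ≤ i₂ * (F * 1) →
  (j + h * G + h * E) * 16 ≤ h * (F * 7) →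
  0 < a → a ≤ b → b ≤ c → c ^ E ≤ b ^ G → 2 * (2 ^ k) ^ h ≤ b → Coprime b c → c ≢ a + b →
  Conclusion E F a b c
large-coefficients {a} {b} {c} E F G h k j i₁ i₂ E≤F i₁+i₂≡h exponents exponents₁ exponents₂ exponents₃
  0<a a≤b b≤c c^E≤b^G large co c≢a+b = build (root k h large)
  where
  a+b+c≤4c : a + b + c ≤ 2 ^ 2 * c
  a+b+c≤4c = ≤-trans (+-mono-≤ (+-mono-≤ (≤-trans a≤b b≤c) b≤c) ≤-refl)
    (≤-trans (m≤m+n (c + c + c) c) (≤-reflexive (four c)))
    where
    four : ∀ c → c + c + c + c ≡ 4 * c
    four = solve-∀
  build : ∃[ t ] (2 ^ k ≤ t × 2 * t ^ h ≤ b × b ≤ 2 ^ suc h * t ^ h) → Conclusion E F a b c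
  build (t , 2^k≤t , low , high) = [ distinct , coinciding ]′ (m≤n⇒m<n∨m≡n a≤b)
    where
    open Sizes {b} {c} {t} {a + b + c} E G (suc h) h k j c^E≤b^G high 2^k≤t a+b+c≤4c exponents
    nonZero-t^ : ∀ i → NonZero (t ^ i)
    nonZero-t^ i = m^n≢0 t i {{>-nonZero (≤-trans (m^n>0 2 k) 2^k≤t)}}
    2≤b : 2 ≤ b
    2≤b = ≤-trans (m≤m*n 2 (t ^ h) {{nonZero-t^ h}}) low
    -- If `b = c`, coprimality gives `b = 1`, against `2 ≤ b`.
    b<c : b < c
    b<c = ≤∧≢⇒< b≤c (λ { refl → <⇒≢ 2≤b (sym (co (∣-refl , ∣-refl))) })
    wide : t ^ i₁ * t ^ i₂ + t ^ i₁ * t ^ i₂ ≤ b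
    wide = ≤-trans (≤-reflexive (trans
      (cong (λ m → m + m) (trans (sym (^-distribˡ-+-* t i₁ i₂)) (cong (t ^_) i₁+i₂≡h)))
      (cong (_+_ (t ^ h)) (sym (+-identityʳ (t ^ h)))))) low
    distinct : a < b → Conclusion E F a b c
    distinct a<b = distinct-coefficients (t ^ i₁) (t ^ i₂) {{nonZero-t^ i₁}} {{nonZero-t^ i₂}}
      0<a a<b b<c c≢a+b co E≤F wide (sparse i₁ F 1 1 exponents₁) (sparse i₂ F 1 2 exponents₂)
    coinciding : a ≡ b → Conclusion E F a b c
    coinciding a≡b = sidon-digits 0<a (≤-trans (s≤s z≤n) 2≤b) E≤F {t ^ h} {{nonZero-t^ h}} a≡b
      (sparse h F 7 16 exponents₃) co (≤-trans (m≤n*m (t ^ h) 2) low)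

theorem2 : ∃[ b₀ ] ∀ (a b c : ℕ) → 0 < a → a ≤ b → b ≤ c → c ^ 100 ≤ b ^ 101 →
    b₀ ≤ b → gcd b c ≡ 1 → c ≢ a + b →
    ∃[ p ] ∃[ q ] (0 < p × 0 < q ×
    (∀ (N : ℕ) → 0 < N →
    ∃[ A ] (Unique A × All (λ x → 1 ≤ x × x ≤ N) A ×
    p ^ 477 * N ^ 100 ≤ q ^ 477 * length A ^ 477 ×
    (∀ {x y z x' y' z'} → x ∈ A → y ∈ A → z ∈ A →
    x' ∈ A → y' ∈ A → z' ∈ A →
    a * x + b * y + c * z ≡ a * x' + b * y' + c * z' →
    Trivial a b c x y z x' y' z'))))
-- The factor t⁵ ≥ 2 ^ (586 * 5) absorbs all constants.
theorem2 = 2 * (2 ^ 586) ^ 26 , λ a b c 0<a a≤b b≤c c^100≤b^101 b₀≤b gcd≡1 c≢a+b →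
  -- The four exponent inequalities read 2927 ≤ 2930, 3331 ≤ 3339, 9062 ≤ 9063 and 83696 ≤ 86814;
  -- given `j = 5`, the first makes 586 the least possible `k`.
  large-coefficients 100 477 101 26 586 5 7 19 (≤ᵇ⇒≤ _ _ _) refl (≤ᵇ⇒≤ _ _ _)
    (≤ᵇ⇒≤ _ _ _) (≤ᵇ⇒≤ _ _ _) (≤ᵇ⇒≤ _ _ _)
    0<a a≤b b≤c c^100≤b^101 b₀≤b (Coprimality.gcd≡1⇒coprime gcd≡1) c≢a+b
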